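{- For every $n\geq1$ there exists a bijection $\varphi:\mathfrak{S}_n(3124,3214)\rightarrow\mathfrak{S}_n(3142,3241)$ such that for every $\pi\in\mathfrak{S}_n(3124,3214)$, $$(\mathrm{Br},\mathrm{Ides},\mathrm{Lrmax},\mathrm{Lrmin},\mathrm{Iar})(\varphi(\pi))=(\mathrm{Br},\mathrm{Ides},\mathrm{Lrmax},\mathrm{Lrmin},\mathrm{Iar})(\pi).$$
   Context: $\mathfrak{S}_n$ is the set of permutations of $[n]$ written as words $\pi_1\cdots\pi_n$; $\mathfrak{S}_n(P_1,\dots,P_r)$ denotes those avoiding each pattern $P_i$ (no subsequence order-isomorphic to $P_i$). For $\pi\in\mathfrak{S}_n$: $\mathrm{Ides}(\pi)=\{i\in[n-1]:\pi^{ -1}(i)>\pi^{ -1}(i+1)\}$; $\mathrm{Lrmax}(\pi)$ (resp. $\mathrm{Lrmin}(\pi)$) is the set of values $\pi_i$ larger (resp. smaller) than all $\pi_j$ with $j<i$; $\mathrm{Iar}(\pi)$ is the set of entries of the initial ascending run $\pi_1<\dots<\pi_m$ ($m$ maximal). With the convention $\pi_0=\pi_{n+1}=0$, $\mathrm{Pk}(\pi)=\{\pi_i:1\le i\le n,\ \pi_{i-1}<\pi_i>\pi_{i+1}\}$, and $\mathrm{Br}(\pi)=\mathrm{Lrmax}(\pi)\cap\mathrm{Pk}(\pi)$. -}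

module Defs where

open import Data.Nat using (ℕ; suc; _≤_)
open import Data.Fin using (Fin; toℕ; _<_; #_)
open import Data.Vec using (Vec; lookup; []; _∷_)
open import Data.Product using (Σ; _×_; ∃-syntax)
open import Relation.Binary.PropositionalEquality using (_≡_)
open import Relation.Nullary using (¬_)

-- A word of length n over the alphabet Fin n; value v : Fin n stands for v+1 ∈ [n].
Word : ℕ → Set
Word n = Vec (Fin n) n

IsPerm : {n : ℕ} → Word n → Set
IsPerm {n} w = (i j : Fin n) → lookup w i ≡ lookup w j → i ≡ j

Contains : {n k : ℕ} → Word n → Vec (Fin k) k → Set
Contains {n} {k} w p =
  Σ (Fin k → Fin n) λ f →
    ((a b : Fin k) → a < b → f a < f b) ×
    ((a b : Fin k) → (lookup p a < lookup p b → lookup w (f a) < lookup w (f b))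
                   × (lookup w (f a) < lookup w (f b) → lookup p a < lookup p b))

Avoids : {n k : ℕ} → Word n → Vec (Fin k) k → Set
Avoids w p = ¬ Contains w p

InAv : {n k : ℕ} → Vec (Fin k) k → Vec (Fin k) k → Word n → Set
InAv p q w = IsPerm w × Avoids w p × Avoids w q

-- patterns, written with values shifted down by one
p3124 p3214 p3142 p3241 : Vec (Fin 4) 4
p3124 = # 2 ∷ # 0 ∷ # 1 ∷ # 3 ∷ []
p3214 = # 2 ∷ # 1 ∷ # 0 ∷ # 3 ∷ []
p3142 = # 2 ∷ # 0 ∷ # 3 ∷ # 1 ∷ []
p3241 = # 2 ∷ # 1 ∷ # 3 ∷ # 0 ∷ []

-- Statistics, as predicates on values v : Fin n (representing v+1).

-- Ides: value v (i.e. v+1) with π⁻¹(v+1) > π⁻¹(v+2)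
Ides : {n : ℕ} → Word n → Fin n → Set
Ides {n} w v = ∃[ p ] ∃[ q ] (lookup w p ≡ v × toℕ (lookup w q) ≡ suc (toℕ v) × q < p)

Lrmax : {n : ℕ} → Word n → Fin n → Set
Lrmax {n} w v = ∃[ i ] (lookup w i ≡ v × ((j : Fin n) → j < i → lookup w j < v))

Lrmin : {n : ℕ} → Word n → Fin n → Set
Lrmin {n} w v = ∃[ i ] (lookup w i ≡ v × ((j : Fin n) → j < i → v < lookup w j))

Iar : {n : ℕ} → Word n → Fin n → Set
Iar {n} w v = ∃[ i ] (lookup w i ≡ v ×
  ((j k : Fin n) → toℕ k ≡ suc (toℕ j) → toℕ k ≤ toℕ i → lookup w j < lookup w k))

-- peaks with the convention π₀ = π_{n+1} = 0
Pk : {n : ℕ} → Word n → Fin n → Set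
Pk {n} w v = ∃[ i ] (lookup w i ≡ v ×
  ((j : Fin n) → suc (toℕ j) ≡ toℕ i → lookup w j < lookup w i) ×
  ((k : Fin n) → toℕ k ≡ suc (toℕ i) → lookup w k < lookup w i))

Br : {n : ℕ} → Word n → Fin n → Set
Br w v = Lrmax w v × Pk w v

SameSet : {n : ℕ} → (Fin n → Set) → (Fin n → Set) → Set
SameSet {n} A B = (v : Fin n) → (A v → B v) × (B v → A v)

{-# OPTIONS --safe #-}
module Submission where

open import Defs
open import Data.Bool using (Bool; true; false)
open import Data.Empty using (⊥; ⊥-elim)
open import Data.Fin as F using (Fin; zero; suc; toℕ; fromℕ<; #_)
open import Data.Fin.Properties using (toℕ-injective; toℕ<n; toℕ-fromℕ<)
import Data.Fin.Properties as F
open import Data.List using (List; []; _∷_; _++_; length; downFrom; take)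
open import Data.List.Membership.Propositional using (_∈_)
open import Data.List.Membership.Propositional.Properties using (∈-++⁺ˡ; ∈-++⁺ʳ; ∈-∃++)
open import Data.List.Properties using (++-assoc; ++-identityʳ; ++-cancelˡ; ∷-injective; length-++; length-downFrom)
open import Data.List.Relation.Binary.Permutation.Propositional using (_↭_; ↭-sym; ↭-trans; ↭-reflexive; ↭-prep; ↭-refl; ↭⇒↭ₛ)
open import Data.List.Relation.Binary.Permutation.Propositional.Properties using (∈-resp-↭; shift; drop-mid; ↭-singleton-inv; ↭-length)
open import Data.List.Relation.Binary.Sublist.Propositional using (_⊆_; []; _∷_; _∷ʳ_; ⊆-refl; ⊆-trans; minimum; from∈; to∈)
open import Data.List.Relation.Binary.Sublist.Propositional.Properties using (++⁺; ++⁺ˡ; ++⁺ʳ; All-resp-⊆)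
open import Data.List.Relation.Unary.All as All using (All; []; _∷_)
import Data.List.Relation.Unary.All.Properties as All
open import Data.List.Relation.Unary.AllPairs using ([]; _∷_)
open import Data.List.Relation.Unary.Any using (Any; here; there)
open import Data.List.Relation.Unary.Unique.Propositional using (Unique)
open import Data.List.Relation.Unary.Unique.Propositional.Properties using (downFrom⁺)
open import Data.Nat using (ℕ; zero; suc; _<_; _≤_; _≥_; s≤s; z≤n)
open import Data.Nat.Properties using (_≟_; <-cmp; <-trans; <-irrefl; <-asym; <⇒≤; ≤-refl; ≤-reflexive; ≤-trans; ≤-<-trans; n<1+n; m<n⇒m<1+n; m≤m+n; ≤-pred; suc-injective; ≤∧≢⇒<)
open import Data.Product using (Σ; _×_; _,_; ∃₂; ∃-syntax; proj₁; proj₂)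
open import Data.Product.Function.NonDependent.Propositional using (_×-⇔_)
open import Data.Sum using (_⊎_; inj₁; inj₂)
open import Data.Sum.Function.Propositional using (_⊎-⇔_)
open import Data.Unit using (⊤; tt)
open import Data.Vec as Vec using (Vec; []; _∷_; lookup; toList)
open import Data.Vec.Properties using (lookup-map; lookup∘tabulate)
open import Function using (_∘_; id; const)
open import Function.Bundles using (_⇔_; mk⇔; module Equivalence)
open import Function.Construct.Composition using (_⇔-∘_)
open import Function.Construct.Identity using (⇔-id)
open import Function.Construct.Symmetry using (⇔-sym)
open import Relation.Binary.Definitions using (tri<; tri≈; tri>)
open import Relation.Binary.PropositionalEquality using (_≡_; _≢_; refl; sym; trans; cong; cong₂; subst; subst₂; setoid)
open import Relation.Nullary using (¬_; yes; no)
open import Data.List.Membership.DecPropositional _≟_ using (_∈?_)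
open import Data.List.Relation.Binary.Permutation.Setoid.Properties (setoid ℕ) using (Unique-resp-↭)
open import Data.List.Relation.Unary.Unique.DecPropositional _≟_ using (unique?)

-- Build permutations by inserting successive maxima. Write a permutation with maximum m as
-- ℓ₁ B₁ ℓ₂ B₂ … ℓⱼ Bⱼ m B, where ℓ₁ < … < ℓⱼ < m are its left-to-right maxima; ℓᵢ is in Br iff Bᵢ is
-- nonempty. In both classes a new maximum may be inserted in front, right after any left-to-right
-- maximum, and at one more place in each nonempty Bᵢ, namely at its end. In B there is at most one
-- more place: for {3142, 3241} the end of B, if B is nonempty; for {3124, 3214} the place after the
-- first letter of B, if that letter exceeds all ℓᵢ in Br. Whether this last place exists evolves
-- in the same way under insertion, so both classes have the same generating tree, and φ matches
-- the permutations at the same node. Lrmax, Br and Iar are read off the sequence of ℓᵢ and the set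
-- of nonempty Bᵢ; Ides and Lrmin only depend on the path from the root.

-- Splitting lists and sublists.

++-split : ∀ {A : Set} (us : List A) {vs} xs {x B} → us ++ vs ≡ xs ++ x ∷ B →
  (∃[ r ] xs ≡ us ++ r × vs ≡ r ++ x ∷ B) ⊎ (∃[ C ] us ≡ xs ++ x ∷ C × B ≡ C ++ vs)
++-split [] xs eq = inj₁ (xs , refl , eq)
++-split (u ∷ us) [] eq with refl , eq′ ← ∷-injective eq = inj₂ (us , refl , sym eq′)
++-split (u ∷ us) (x ∷ xs) eq with ∷-injective eq
... | refl , eq′ with ++-split us xs eq′
...   | inj₁ (r , refl , eq″) = inj₁ (r , refl , eq″)
...   | inj₂ (C , refl , eq″) = inj₂ (C , refl , eq″)

⊆-split : ∀ {A : Set} {zs : List A} xs {ys} → zs ⊆ xs ++ ys →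
  ∃₂ λ zs₁ zs₂ → zs ≡ zs₁ ++ zs₂ × zs₁ ⊆ xs × zs₂ ⊆ ys
⊆-split [] s = [] , _ , refl , [] , s
⊆-split (x ∷ xs) (.x ∷ʳ s) with zs₁ , zs₂ , eq , s₁ , s₂ ← ⊆-split xs s =
  zs₁ , zs₂ , eq , x ∷ʳ s₁ , s₂
⊆-split (x ∷ xs) (refl ∷ s) with zs₁ , zs₂ , eq , s₁ , s₂ ← ⊆-split xs s =
  x ∷ zs₁ , zs₂ , cong (x ∷_) eq , refl ∷ s₁ , s₂

All-⊆ : ∀ {P : ℕ → Set} {x xs} → All P xs → x ∷ [] ⊆ xs → P x
All-⊆ p s = All.lookup p (to∈ s)

skip-mid : ∀ {A : Set} (us : List A) {x vs} → us ++ vs ⊆ us ++ x ∷ vs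
skip-mid us = ++⁺ (⊆-refl {x = us}) (_ ∷ʳ ⊆-refl)

-- Forbidden occurrences and structured words.

-- I is the class avoiding {3124, 3214} and II the class avoiding {3142, 3241}.
data Class : Set where
  I II : Class

occurrence : Class → ℕ → ℕ → ℕ → ℕ → List ℕ
occurrence I  c a b d = c ∷ a ∷ b ∷ d ∷ []
occurrence II c a b d = c ∷ a ∷ d ∷ b ∷ []

-- The order of `a` and `b` is left open, so one shape covers both forbidden patterns of a class:
-- 3124 and 3214 for `I`, 3142 and 3241 for `II`.
record Bad (k : Class) (xs : List ℕ) : Set where
  constructor bad
  field
    {c a b d} : ℕ
    occ : occurrence k c a b d ⊆ xs
    a<c : a < c
    b<c : b < c
    c<d : c < d

Bad-⊆ : ∀ {k xs ys} → xs ⊆ ys → Bad k xs → Bad k ys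
Bad-⊆ s (bad occ p q r) = bad (⊆-trans occ s) p q r

-- The left-to-right maxima ℓᵢ, last one first, each flagged with whether Bᵢ is nonempty.
State : Set
State = List (ℕ × Bool)

-- A flagged maximum ℓ has a smaller letter in its block, so the two can serve as `c` and `a` of an
-- occurrence, and a later letter below ℓ as `b`. Such a letter in a later block is fatal: `d` is
-- then the overall maximum in class `I`, and the head of that later block in class `II`.
Above : State → ℕ → Set
Above S x = All (λ p → proj₂ p ≡ true → proj₁ p < x) S

Below : State → ℕ → Set
Below S x = Any (λ p → proj₂ p ≡ true × x < proj₁ p) S

-- In class `I`, two letters of one block, with the block's head in front and the overall maximum
-- behind, form an occurrence; blocks therefore have a single letter there.
BlockTail : Class → List ℕ → Set
BlockTail I  B = B ≡ []
BlockTail II B = ⊤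

-- The part ℓ₁ B₁ … ℓⱼ Bⱼ to the left of the maximum.
data Low (k : Class) : State → Set
flat : ∀ {k S} → Low k S → List ℕ

data Low k where
  []  : Low k []
  run : ∀ {S ℓ} (lo : Low k S) → All (_< ℓ) (flat lo) → Low k ((ℓ , false) ∷ S)
  blk : ∀ {S ℓ} (lo : Low k S) → All (_< ℓ) (flat lo) → ∀ b B → All (_< ℓ) (b ∷ B) →
        All (Above S) (b ∷ B) → BlockTail k B → Low k ((ℓ , true) ∷ S)

flat [] = []
flat (run {ℓ = ℓ} lo _) = flat lo ++ ℓ ∷ []
flat (blk {ℓ = ℓ} lo _ b B _ _ _) = flat lo ++ ℓ ∷ b ∷ B

-- The part B to the right of the maximum, flagged with whether a new maximum fits inside or after B.
data Top : Class → Bool → State → List ℕ → Set where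
  []    : ∀ {k S} → Top k false S []
  below : ∀ {S b B} → Below S b → Top I false S (b ∷ B)
  aboveI  : ∀ {S b B} → Above S b → Top I true S (b ∷ B)
  aboveII : ∀ {S b B} → All (Above S) (b ∷ B) → Top II true S (b ∷ B)

record Structured (k : Class) (m : ℕ) (f : Bool) (S : State) : Set where
  constructor str
  field
    low  : Low k S
    low< : All (_< m) (flat low)
    rest : List ℕ
    rest< : All (_< m) rest
    top  : Top k f S rest

  left : List ℕ
  left = flat low

  word : List ℕ
  word = left ++ m ∷ rest

open Structured

-- Insertion places and the generating tree.

-- The places in ℓ₁ B₁ … ℓⱼ Bⱼ, indexed also by the state of the part to the left of the place:
-- right after ℓⱼ (at), after a nonempty Bⱼ (after), or further left (skip).
data LowSite : State → State → Set where
  front : LowSite [] []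
  at    : ∀ {ℓ f S} → LowSite ((ℓ , f) ∷ S) ((ℓ , false) ∷ S)
  after : ∀ {ℓ S} → LowSite ((ℓ , true) ∷ S) ((ℓ , true) ∷ S)
  skip  : ∀ {p S T} → LowSite S T → LowSite (p ∷ S) T

-- The indices are the flag and state before and after the insertion. `at` is right behind the old
-- maximum. `after` is the extra place whose position depends on the class; using it closes it,
-- whereas any insertion to the left of the old maximum opens it again.
data Site (m : ℕ) : Bool → State → Bool → State → Set where
  at    : ∀ {f S} → Site m f S f ((m , false) ∷ S)
  after : ∀ {S} → Site m true S false ((m , true) ∷ S)
  before : ∀ {f S T} → LowSite S T → Site m f S true T

-- The paths from the root in the generating tree shared by both classes.
data Code : ℕ → Bool → State → Set where
  root : Code 0 false []
  _▸_  : ∀ {m f S g T} → Code m f S → Site m f S g T → Code (suc m) g T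

-- Insertion of a new maximum.

cutˡ : ∀ {k S T} → Low k S → LowSite S T → Low k T
cutˡ [] front = []
cutˡ (run lo p) at = run lo p
cutˡ (run lo p) (skip s) = cutˡ lo s
cutˡ (blk lo p b B q r t) at = run lo p
cutˡ (blk lo p b B q r t) after = blk lo p b B q r t
cutˡ (blk lo p b B q r t) (skip s) = cutˡ lo s

cutʳ : ∀ {k S T} → Low k S → LowSite S T → List ℕ
cutʳ [] front = []
cutʳ (run lo p) at = []
cutʳ (run {ℓ = ℓ} lo p) (skip s) = cutʳ lo s ++ ℓ ∷ []
cutʳ (blk lo p b B q r t) at = b ∷ B
cutʳ (blk lo p b B q r t) after = []
cutʳ (blk {ℓ = ℓ} lo p b B q r t) (skip s) = cutʳ lo s ++ ℓ ∷ b ∷ B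

cut-++ : ∀ {k S T} (lo : Low k S) (s : LowSite S T) → flat (cutˡ lo s) ++ cutʳ lo s ≡ flat lo
cut-++ [] front = refl
cut-++ (run lo p) at = ++-identityʳ _
cut-++ (run lo p) (skip s) = trans (sym (++-assoc (flat (cutˡ lo s)) _ _)) (cong (_++ _) (cut-++ lo s))
cut-++ (blk lo p b B q r t) at = ++-assoc (flat lo) _ _
cut-++ (blk lo p b B q r t) after = ++-identityʳ _
cut-++ (blk lo p b B q r t) (skip s) = trans (sym (++-assoc (flat (cutˡ lo s)) _ _)) (cong (_++ _) (cut-++ lo s))

state-< : ∀ {k S x} (lo : Low k S) → All (_< x) (flat lo) → All (λ p → proj₁ p < x) S
state-< [] _ = []
state-< (run lo _) h with h₁ , ℓ< ∷ _ ← All.++⁻ (flat lo) h = ℓ< ∷ state-< lo h₁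
state-< (blk lo _ _ _ _ _ _) h with h₁ , ℓ< ∷ _ ← All.++⁻ (flat lo) h = ℓ< ∷ state-< lo h₁

low-above : ∀ {k S x} (lo : Low k S) → All (_< x) (flat lo) → Above S x
low-above lo h = All.map const (state-< lo h)

top-tail : ∀ {k p S V} → Top k true (p ∷ S) V → Top k true S V
top-tail (aboveI (_ ∷ q)) = aboveI q
top-tail (aboveII qs) = aboveII (All.map All.tail qs)

top-all : ∀ {f S V} → Top II f S V → All (Above S) V
top-all [] = []
top-all (aboveII qs) = qs

top-cons : ∀ {k f S x xs V} → Above S x → All (Above S) xs → Top k f S V → Top k true S (x ∷ xs ++ V)
top-cons {I} q qs t = aboveI q
top-cons {II} q qs t = aboveII (q ∷ All.++⁺ qs (top-all t))

top-unmarked : ∀ {k f S ℓ V} → Top k f S V → Top k f ((ℓ , false) ∷ S) V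
top-unmarked [] = []
top-unmarked (below q) = below (there q)
top-unmarked (aboveI q) = aboveI ((λ ()) ∷ q)
top-unmarked (aboveII qs) = aboveII (All.map ((λ ()) ∷_) qs)

-- A letter passing to the right of the cut is either a left-to-right maximum, larger than all
-- before it, or a block letter, which exceeds the flagged maxima before its block. If the cut
-- separates a block from its head, that head loses its flag and imposes no condition.
cut-top : ∀ {k S T V} (lo : Low k S) (s : LowSite S T) → Top k true S V → Top k true T (cutʳ lo s ++ V)
cut-top [] front t = t
cut-top (run lo p) at t = t
cut-top {V = V} (run {ℓ = ℓ} lo p) (skip s) t =
  subst (Top _ _ _) (sym (++-assoc (cutʳ lo s) (ℓ ∷ []) V))
    (cut-top lo s (top-cons (low-above lo p) [] (top-tail t)))
cut-top (blk lo p b B q (r ∷ rs) _) at t = top-unmarked (top-cons r rs (top-tail t))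
cut-top (blk lo p b B q r _) after t = t
cut-top {V = V} (blk {ℓ = ℓ} lo p b B q r _) (skip s) t =
  subst (Top _ _ _) (sym (++-assoc (cutʳ lo s) (ℓ ∷ b ∷ B) V))
    (cut-top lo s (top-cons (low-above lo p) r (top-tail t)))

weaken-< : ∀ {m xs} → All (_< m) xs → All (_< suc m) xs
weaken-< = All.map m<n⇒m<1+n

insertMax : ∀ {k m f S g T} (w : Structured k m f S) → Site m f S g T →
  Σ (Structured k (suc m) g T) λ w′ → left w′ ++ rest w′ ≡ word w
insertMax {m = m} (str lo lo< B B< t) at =
  str (run lo lo<) (All.++⁺ (weaken-< lo<) (n<1+n m ∷ [])) B (weaken-< B<) (top-unmarked t) ,
  ++-assoc (flat lo) _ _
insertMax {I} {m} (str lo lo< (b ∷ B) (b< ∷ B<) (aboveI q)) after =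
  str (blk lo lo< b [] (b< ∷ []) (q ∷ []) refl)
      (All.++⁺ (weaken-< lo<) (n<1+n m ∷ m<n⇒m<1+n b< ∷ [])) B (weaken-< B<) (new-top B<) ,
  ++-assoc (flat lo) _ _
  where
  -- After this insertion `m` is flagged and exceeds every remaining letter, so no extra place is
  -- left.
  new-top : ∀ {S B} → All (_< m) B → Top I false ((m , true) ∷ S) B
  new-top [] = []
  new-top (b< ∷ _) = below (here (refl , b<))
insertMax {II} {m} (str lo lo< (b ∷ B) B< (aboveII qs)) after =
  str (blk lo lo< b B B< qs tt)
      (All.++⁺ (weaken-< lo<) (n<1+n m ∷ weaken-< B<)) [] [] [] ,
  ++-identityʳ _
insertMax {k} {m} {S = S} {T = T} w@(str lo lo< B B< t) (before s) =
  str (cutˡ lo s) (proj₁ bounds) (cutʳ lo s ++ m ∷ B) (proj₂ bounds)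
      (cut-top lo s (top-cons (low-above lo lo<) [] t)) , eq
  where
  eq : flat (cutˡ lo s) ++ cutʳ lo s ++ m ∷ B ≡ word w
  eq = trans (sym (++-assoc (flat (cutˡ lo s)) _ _)) (cong (_++ m ∷ B) (cut-++ lo s))
  bounds : All (_< suc m) (flat (cutˡ lo s)) × All (_< suc m) (cutʳ lo s ++ m ∷ B)
  bounds = All.++⁻ (flat (cutˡ lo s))
    (subst (All (_< suc m)) (sym eq) (All.++⁺ (weaken-< lo<) (n<1+n m ∷ weaken-< B<)))

decode : ∀ k {m f S} → Code m f S → Structured k m f S
decode k root = str [] [] [] [] []
decode k (c ▸ s) = proj₁ (insertMax (decode k c) s)

parent-eq : ∀ k {m f S g T} (c : Code m f S) (s : Site m f S g T) →
  left (decode k (c ▸ s)) ++ rest (decode k (c ▸ s)) ≡ word (decode k c)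
parent-eq k c s = proj₂ (insertMax (decode k c) s)

decode-↭ : ∀ k {m f S} (c : Code m f S) → word (decode k c) ↭ downFrom (suc m)
decode-↭ k root = ↭-refl
decode-↭ k (c ▸ s) =
  ↭-trans (shift _ (left w) (rest w))
    (↭-prep _ (↭-trans (↭-reflexive (parent-eq k c s)) (decode-↭ k c)))
  where
  w = decode k (c ▸ s)

-- Decoded words avoid the patterns.

block-inversion : ∀ {k S ℓ c a B} (lo : Low k S) → All (_< ℓ) (flat lo) → All (_< ℓ) B →
  c ∷ a ∷ [] ⊆ flat lo ++ ℓ ∷ B → a < c → (c ∷ a ∷ [] ⊆ flat lo) ⊎ (c ≤ ℓ × a ∈ B)
block-inversion lo p q s a<c with ⊆-split (flat lo) s
... | [] , _ , refl , _ , (_ ∷ʳ s₂) = inj₂ (<⇒≤ (All-⊆ q (⊆-trans (refl ∷ minimum _) s₂)) , to∈ (⊆-trans (_ ∷ʳ refl ∷ []) s₂))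
... | [] , _ , refl , _ , (refl ∷ s₂) = inj₂ (≤-refl , to∈ s₂)
... | _ ∷ [] , _ , refl , s₁ , (_ ∷ʳ s₂) = inj₂ (<⇒≤ (All-⊆ p s₁) , to∈ s₂)
... | _ ∷ [] , _ , refl , s₁ , (refl ∷ s₂) = ⊥-elim (<-asym a<c (All-⊆ p s₁))
... | _ ∷ _ ∷ [] , [] , refl , s₁ , _ = inj₁ s₁

-- A left-to-right maximum is never the lower letter of an inversion, so `a` lies in a block. The
-- head of that block is flagged, is at least `c`, and is exceeded by `x`.
low-inversion : ∀ {k S c a x} (lo : Low k S) → c ∷ a ∷ [] ⊆ flat lo → a < c → Above S x → c < x
low-inversion (run lo p) s a<c (_ ∷ h) with block-inversion lo p [] s a<c
... | inj₁ s′ = low-inversion lo s′ a<c h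
low-inversion (blk lo p b B q _ _) s a<c (ℓ< ∷ h) with block-inversion lo p q s a<c
... | inj₁ s′ = low-inversion lo s′ a<c h
... | inj₂ (c≤ℓ , _) = ≤-<-trans c≤ℓ (ℓ< refl)

-- Both `a` and `b` would be block letters, hence in different blocks, as those of class `I` have
-- one letter each. But the later block letter `b` exceeds all flagged maxima before its block, and
-- then `low-inversion` puts it above `c`.
low-no-double-inversion : ∀ {S c a b} (lo : Low I S) → c ∷ a ∷ b ∷ [] ⊆ flat lo → a < c → b < c → ⊥
low-no-double-inversion (run {ℓ = ℓ} lo p) s a<c b<c with ⊆-split (flat lo) s
... | [] , _ , refl , _ , (_ ∷ʳ ())
... | [] , _ , refl , _ , (refl ∷ ())
... | _ ∷ [] , _ , refl , _ , (_ ∷ʳ ())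
... | _ ∷ [] , _ , refl , _ , (refl ∷ ())
... | _ ∷ _ ∷ [] , _ , refl , s₁ , (refl ∷ _) = <-asym b<c (All-⊆ p (⊆-trans (refl ∷ minimum _) s₁))
... | _ ∷ _ ∷ _ ∷ [] , [] , refl , s₁ , _ = low-no-double-inversion lo s₁ a<c b<c
low-no-double-inversion (blk lo p b [] q (r ∷ []) refl) s a<c b<c with ⊆-split (flat lo) s
... | [] , _ , refl , _ , (_ ∷ʳ (_ ∷ʳ ()))
... | [] , _ , refl , _ , (_ ∷ʳ (_ ∷ ()))
... | [] , _ , refl , _ , (refl ∷ (_ ∷ʳ ()))
... | [] , _ , refl , _ , (refl ∷ (_ ∷ ()))
... | _ ∷ [] , _ , refl , s₁ , (_ ∷ʳ (_ ∷ʳ ()))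
... | _ ∷ [] , _ , refl , s₁ , (_ ∷ʳ (_ ∷ ()))
... | _ ∷ [] , _ , refl , s₁ , (refl ∷ _) = <-asym a<c (All-⊆ p s₁)
... | _ ∷ _ ∷ [] , _ , refl , s₁ , (refl ∷ _) = <-asym b<c (All-⊆ p (⊆-trans (refl ∷ minimum _) s₁))
... | _ ∷ _ ∷ [] , _ , refl , s₁ , (_ ∷ʳ (refl ∷ _)) = <-asym b<c (low-inversion lo s₁ a<c r)
... | _ ∷ _ ∷ _ ∷ [] , [] , refl , s₁ , _ = low-no-double-inversion lo s₁ a<c b<c

-- A new occurrence must use the new maximum as its letter 4.
insertMax-avoids : ∀ {k m f S} (w : Structured k m f S) → ¬ Bad k (left w ++ rest w) → ¬ Bad k (word w)
insertMax-avoids w avoids (bad occ a<c b<c c<d) with ⊆-split (left w) occ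
... | zs₁ , zs₂ , eq , s₁ , (_ ∷ʳ s₂) =
  avoids (bad (subst (_⊆ left w ++ rest w) (sym eq) (++⁺ s₁ s₂)) a<c b<c c<d)
-- The number of letters left of the maximum tells which letter of the occurrence it plays; every
-- role but `d` contradicts maximality.
insertMax-avoids {I} w avoids (bad occ a<c b<c c<d) | [] , _ , refl , s₁ , (refl ∷ s₂) =
  <-asym c<d (All-⊆ (rest< w) (⊆-trans (_ ∷ʳ _ ∷ʳ ⊆-refl) s₂))
insertMax-avoids {I} w avoids (bad occ a<c b<c c<d) | _ ∷ [] , _ , refl , s₁ , (refl ∷ s₂) =
  <-asym a<c (All-⊆ (low< w) s₁)
insertMax-avoids {I} w avoids (bad occ a<c b<c c<d) | _ ∷ _ ∷ [] , _ , refl , s₁ , (refl ∷ s₂) =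
  <-asym b<c (All-⊆ (low< w) (⊆-trans (refl ∷ minimum _) s₁))
insertMax-avoids {I} w avoids (bad occ a<c b<c c<d) | _ ∷ _ ∷ _ ∷ [] , _ , refl , s₁ , (refl ∷ s₂) =
  low-no-double-inversion (low w) s₁ a<c b<c
insertMax-avoids {I} w avoids (bad occ a<c b<c c<d) | _ ∷ _ ∷ _ ∷ _ ∷ [] , _ , () , s₁ , (refl ∷ s₂)
insertMax-avoids {I} w avoids (bad occ a<c b<c c<d) | _ ∷ _ ∷ _ ∷ _ ∷ _ ∷ _ , _ , () , s₁ , (refl ∷ s₂)
insertMax-avoids {II} w avoids (bad occ a<c b<c c<d) | [] , _ , refl , s₁ , (refl ∷ s₂) =
  <-asym c<d (All-⊆ (rest< w) (⊆-trans (_ ∷ʳ refl ∷ minimum _) s₂))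
insertMax-avoids {II} w avoids (bad occ a<c b<c c<d) | _ ∷ [] , _ , refl , s₁ , (refl ∷ s₂) =
  <-asym a<c (All-⊆ (low< w) s₁)
insertMax-avoids {II} w avoids (bad occ a<c b<c c<d) | _ ∷ _ ∷ [] , _ , refl , s₁ , (refl ∷ s₂) =
  <-asym b<c (low-inversion (low w) s₁ a<c (All.lookup (top-all (top w)) (to∈ s₂)))
insertMax-avoids {II} w avoids (bad occ a<c b<c c<d) | _ ∷ _ ∷ _ ∷ [] , _ , refl , s₁ , (refl ∷ s₂) =
  <-asym b<c (All-⊆ (low< w) (⊆-trans (refl ∷ minimum _) s₁))
insertMax-avoids {II} w avoids (bad occ a<c b<c c<d) | _ ∷ _ ∷ _ ∷ _ ∷ [] , _ , () , s₁ , (refl ∷ s₂)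
insertMax-avoids {II} w avoids (bad occ a<c b<c c<d) | _ ∷ _ ∷ _ ∷ _ ∷ _ ∷ _ , _ , () , s₁ , (refl ∷ s₂)

decode-avoids : ∀ k {m f S} (c : Code m f S) → ¬ Bad k (word (decode k c))
decode-avoids I  root (bad (_ ∷ʳ ()) _ _ _)
decode-avoids I  root (bad (_ ∷ ()) _ _ _)
decode-avoids II root (bad (_ ∷ʳ ()) _ _ _)
decode-avoids II root (bad (_ ∷ ()) _ _ _)
decode-avoids k (c ▸ s) = insertMax-avoids (decode k (c ▸ s))
  (decode-avoids k c ∘ subst (Bad k) (parent-eq k c s))

-- Different sites give different words.

length-snoc : ∀ (xs : List ℕ) {x ys} → length xs < length (xs ++ x ∷ ys)
length-snoc [] = s≤s z≤n
length-snoc (_ ∷ xs) = s≤s (length-snoc xs)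

length-snoc₂ : ∀ (xs : List ℕ) {x y ys} → length (xs ++ x ∷ []) < length (xs ++ x ∷ y ∷ ys)
length-snoc₂ [] = s≤s (s≤s z≤n)
length-snoc₂ (_ ∷ xs) = s≤s (length-snoc₂ xs)

cut-length : ∀ {k S T} (lo : Low k S) (s : LowSite S T) → length (flat (cutˡ lo s)) ≤ length (flat lo)
cut-length lo s = ≤-trans (m≤m+n _ (length (cutʳ lo s)))
  (≤-reflexive (trans (sym (length-++ (flat (cutˡ lo s)))) (cong length (cut-++ lo s))))

<-cong-absurd : {xs ys : List ℕ} → length xs < length ys → xs ≡ ys → ⊥
<-cong-absurd lt refl = <-irrefl refl lt

-- Places are told apart by the length of the part to their left: those under `skip` end no later
-- than the inner `flat lo`, `at` includes one letter more, and `after` is longer still.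
cut-injective : ∀ {k S T T′} (lo : Low k S) (s : LowSite S T) (s′ : LowSite S T′) →
  flat (cutˡ lo s) ≡ flat (cutˡ lo s′) → (T , s) ≡ (T′ , s′)
cut-injective [] front front _ = refl
cut-injective (run lo p) at at _ = refl
cut-injective (run lo p) at (skip s) eq =
  ⊥-elim (<-cong-absurd (≤-<-trans (cut-length lo s) (length-snoc (flat lo))) (sym eq))
cut-injective (run lo p) (skip s) at eq =
  ⊥-elim (<-cong-absurd (≤-<-trans (cut-length lo s) (length-snoc (flat lo))) eq)
cut-injective (run lo p) (skip s) (skip s′) eq with refl ← cut-injective lo s s′ eq = refl
cut-injective (blk lo p b B q r t) at at _ = refl
cut-injective (blk lo p b B q r t) at after eq = ⊥-elim (<-cong-absurd (length-snoc₂ (flat lo)) eq)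
cut-injective (blk lo p b B q r t) after at eq = ⊥-elim (<-cong-absurd (length-snoc₂ (flat lo)) (sym eq))
cut-injective (blk lo p b B q r t) after after _ = refl
cut-injective (blk lo p b B q r t) at (skip s) eq =
  ⊥-elim (<-cong-absurd (≤-<-trans (cut-length lo s) (length-snoc (flat lo))) (sym eq))
cut-injective (blk lo p b B q r t) after (skip s) eq =
  ⊥-elim (<-cong-absurd (≤-<-trans (cut-length lo s) (length-snoc (flat lo))) (sym eq))
cut-injective (blk lo p b B q r t) (skip s) at eq =
  ⊥-elim (<-cong-absurd (≤-<-trans (cut-length lo s) (length-snoc (flat lo))) eq)
cut-injective (blk lo p b B q r t) (skip s) after eq =
  ⊥-elim (<-cong-absurd (≤-<-trans (cut-length lo s) (length-snoc (flat lo))) eq)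
cut-injective (blk lo p b B q r t) (skip s) (skip s′) eq with refl ← cut-injective lo s s′ eq = refl

after-length : ∀ {k m S} (w : Structured k m true S) →
  length (left w ++ m ∷ []) < length (left (proj₁ (insertMax w after)))
after-length {I} (str lo _ (_ ∷ _) (_ ∷ _) (aboveI _)) = length-snoc₂ (flat lo)
after-length {II} (str lo _ (_ ∷ _) _ (aboveII _)) = length-snoc₂ (flat lo)

before-length : ∀ {k m f S T} (w : Structured k m f S) (s : LowSite S T) →
  length (flat (cutˡ (low w) s)) < length (left w ++ m ∷ [])
before-length w s = ≤-<-trans (cut-length (low w) s) (length-snoc (left w))

-- The left parts grow strictly in length from `before` to `at` to `after`; among the `before` sites
-- `cut-injective` decides.
site-injective : ∀ {k m f S g T g′ T′} (w : Structured k m f S) (s : Site m f S g T) (s′ : Site m f S g′ T′) →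
  left (proj₁ (insertMax w s)) ≡ left (proj₁ (insertMax w s′)) →
  _≡_ {A = ∃₂ (Site m f S)} (g , T , s) (g′ , T′ , s′)
site-injective w at at _ = refl
site-injective w at after eq = ⊥-elim (<-cong-absurd (after-length w) eq)
site-injective w at (before s) eq = ⊥-elim (<-cong-absurd (before-length w s) (sym eq))
site-injective w after at eq = ⊥-elim (<-cong-absurd (after-length w) (sym eq))
site-injective w after after _ = refl
site-injective w after (before s) eq = ⊥-elim (<-cong-absurd (<-trans (before-length w s) (after-length w)) (sym eq))
site-injective w (before s) at eq = ⊥-elim (<-cong-absurd (before-length w s) eq)
site-injective w (before s) after eq = ⊥-elim (<-cong-absurd (<-trans (before-length w s) (after-length w)) eq)
site-injective w (before s) (before s′) eq with refl ← cut-injective (low w) s s′ eq = refl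

-- The generating tree enumerates each class exactly once

AnyCode : ℕ → Set
AnyCode m = ∃₂ (Code m)

wordOf : ∀ k {m} → AnyCode m → List ℕ
wordOf k (_ , _ , c) = word (decode k c)

split-at-max : ∀ {x us us′ vs vs′} → All (_< x) us → All (_< x) us′ →
  us ++ x ∷ vs ≡ us′ ++ x ∷ vs′ → us ≡ us′ × vs ≡ vs′
split-at-max [] [] refl = refl , refl
split-at-max [] (p ∷ _) refl = ⊥-elim (<-irrefl refl p)
split-at-max (p ∷ _) [] refl = ⊥-elim (<-irrefl refl p)
split-at-max (_ ∷ ps) (_ ∷ qs) eq with ∷-injective eq
... | refl , eq′ with refl , refl ← split-at-max ps qs eq′ = refl , refl

-- The last insertion can be undone: splitting at the maximum gives two parts whose concatenation is
-- the parent word, and the left part determines the site.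
wordOf-injective : ∀ k {m} (c c′ : AnyCode m) → wordOf k c ≡ wordOf k c′ → c ≡ c′
wordOf-injective k (_ , _ , root) (_ , _ , root) _ = refl
wordOf-injective k (_ , _ , (c ▸ s)) (_ , _ , (c′ ▸ s′)) eq
  with eqˡ , eqʳ ← split-at-max (low< (decode k (c ▸ s))) (low< (decode k (c′ ▸ s′))) eq
  with refl ← wordOf-injective k (_ , _ , c) (_ , _ , c′)
         (trans (sym (parent-eq k c s)) (trans (cong₂ _++_ eqˡ eqʳ) (parent-eq k c′ s′)))
  with refl ← site-injective (decode k c) s s′ eqˡ = refl

-- The configuration c a … b with a, b < c that forbids inserting a maximum between us and vs.
record Blocked (k : Class) (us vs : List ℕ) : Set where
  constructor blocked
  field
    isII : k ≡ II
    {c a b} : ℕ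
    ca⊆us : c ∷ a ∷ [] ⊆ us
    b∈vs  : b ∈ vs
    a<c   : a < c
    b<c   : b < c

-- A cut that is not a place lies strictly between the first letter of a block and its end. Class
-- `I` has no such cut; in class `II` the head, the first letter of the block and the letter right
-- of the cut are the `c`, `a` and `b` of `Blocked`.
find-low : ∀ {k S} (lo : Low k S) us r → us ++ r ≡ flat lo →
  (∃₂ λ T (s : LowSite S T) → flat (cutˡ lo s) ≡ us) ⊎ Blocked k us r
find-low [] [] [] refl = inj₁ (_ , front , refl)
find-low (run lo p) us r eq with ++-split us (flat lo) eq
... | inj₂ ([] , refl , refl) = inj₁ (_ , at , refl)
... | inj₁ (r′ , eq′ , refl) with find-low lo us r′ (sym eq′)
...   | inj₁ (_ , s , eq″) = inj₁ (_ , skip s , eq″)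
...   | inj₂ (blocked k≡II s i x y) = inj₂ (blocked k≡II s (∈-++⁺ˡ i) x y)
find-low {k} (blk lo p b B (b< ∷ B<) q t) us r eq with ++-split us (flat lo) eq
... | inj₂ ([] , refl , refl) = inj₁ (_ , at , refl)
... | inj₁ (r′ , eq′ , refl) with find-low lo us r′ (sym eq′)
...   | inj₁ (_ , s , eq″) = inj₁ (_ , skip s , eq″)
...   | inj₂ (blocked k≡II s i x y) = inj₂ (blocked k≡II s (∈-++⁺ˡ i) x y)
find-low {k} (blk lo p b B (b< ∷ B<) q t) us [] eq | inj₂ (_ ∷ C , refl , refl) =
  inj₁ (_ , after , cong (λ X → flat lo ++ _ ∷ b ∷ X) (++-identityʳ C))
find-low {I} (blk lo p b B (b< ∷ B<) q t) us (y ∷ r) eq | inj₂ (_ ∷ [] , refl , refl) with () ← t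
find-low {I} (blk lo p b B (b< ∷ B<) q t) us (y ∷ r) eq | inj₂ (_ ∷ _ ∷ C , refl , refl) with () ← t
find-low {II} (blk lo p b B (b< ∷ B<) q t) us (y ∷ r) eq | inj₂ (_ ∷ C , refl , refl) =
  inj₂ (blocked refl (++⁺ˡ (flat lo) (refl ∷ refl ∷ minimum C)) (here refl) b< (All.lookup B< (∈-++⁺ʳ C (here refl))))

-- `c` is a flagged maximum above `x`, and `a` the first letter of its block.
marked-inversion : ∀ {k S x} (lo : Low k S) → Below S x → ∃₂ λ c a → c ∷ a ∷ [] ⊆ flat lo × a < c × x < c
marked-inversion (run lo p) (here (() , _))
marked-inversion (run lo p) (there h) with c , a , s , q ← marked-inversion lo h = c , a , ++⁺ʳ _ s , q
marked-inversion (blk lo p b B (b< ∷ _) _ _) (here (_ , x<)) = _ , b , ++⁺ˡ (flat lo) (refl ∷ refl ∷ minimum B) , b< , x<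
marked-inversion (blk lo p b B _ _ _) (there h) with c , a , s , q ← marked-inversion lo h = c , a , ++⁺ʳ _ s , q

-- At a cut that is no site the new maximum becomes the `d` of an occurrence. Inside the left part,
-- `c` is the head of the block being cut. Right of the old maximum `m`, `c` is `m` itself, except
-- at the class `I` cut behind a first letter that lies below a flagged maximum: there `c` is that
-- flagged maximum.
find-site : ∀ {k m f S} (w : Structured k m f S) us vs → us ++ vs ≡ word w →
  (∃₂ λ g T → Σ (Site m f S g T) λ s → left (proj₁ (insertMax w s)) ≡ us) ⊎ Bad k (us ++ suc m ∷ vs)
find-site {m = m} w us vs eq with ++-split us (left w) eq
find-site {m = m} w us vs eq | inj₁ (r , eq′ , refl) with find-low (low w) us r (sym eq′)
... | inj₁ (_ , s , eq″) = inj₁ (_ , _ , before s , eq″)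
... | inj₂ (blocked refl s i x y) = inj₂ (bad (++⁺ s (refl ∷ ⊆-trans (from∈ i) (++⁺ʳ _ ⊆-refl))) x y
        (m<n⇒m<1+n (All-⊆ (low< w) (subst (_ ⊆_) (sym eq′) (++⁺ʳ r (⊆-trans (refl ∷ minimum _) s))))))
find-site w us vs eq | inj₂ ([] , refl , _) = inj₁ (_ , _ , at , refl)
find-site {I} {m} (str lo lo< (b ∷ B) (b< ∷ B<) (aboveI q)) us vs eq | inj₂ (_ ∷ [] , refl , refl) = inj₁ (_ , _ , after , refl)
find-site {I} {m} (str lo lo< (b ∷ B) (b< ∷ B<) (below q)) us vs eq | inj₂ (_ ∷ [] , refl , refl)
  with c , a , s , a<c , b<c ← marked-inversion lo q =
  inj₂ (bad (++⁺ (++⁺ s (_ ∷ʳ refl ∷ [])) (refl ∷ minimum vs)) a<c b<c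
          (m<n⇒m<1+n (All-⊆ lo< (⊆-trans (refl ∷ minimum _) s))))
find-site {I} {m} (str lo lo< (b ∷ B) (b< ∷ b′< ∷ B<) _) us vs eq | inj₂ (_ ∷ b′ ∷ C , refl , refl) =
  inj₂ (bad (++⁺ (++⁺ˡ (flat lo) (refl ∷ refl ∷ refl ∷ minimum C)) (refl ∷ minimum vs)) b< b′< (n<1+n m))
find-site {II} {m} (str lo lo< (b ∷ B) (b< ∷ B<) (aboveII q)) us [] eq | inj₂ (_ ∷ C , refl , refl) =
  inj₁ (_ , _ , after , cong (λ X → flat lo ++ m ∷ b ∷ X) (++-identityʳ C))
find-site {II} {m} (str lo lo< (b ∷ B) (b< ∷ B<) (aboveII q)) us (v ∷ vs) eq | inj₂ (_ ∷ C , refl , refl) =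
  inj₂ (bad (++⁺ (++⁺ˡ (flat lo) (refl ∷ refl ∷ minimum C)) (refl ∷ refl ∷ minimum vs)) b<
          (All.lookup B< (∈-++⁺ʳ C (here refl))) (n<1+n m))

-- The alternative makes induction possible without assuming avoidance: the maximum is deleted, and
-- an occurrence in the shorter word survives its return.
wordOf-surjective : ∀ k m xs → xs ↭ downFrom (suc m) → (∃[ c ] wordOf k {m} c ≡ xs) ⊎ Bad k xs
wordOf-surjective k zero xs p = inj₁ ((_ , _ , root) , sym (↭-singleton-inv p))
wordOf-surjective k (suc m) xs p with ∈-∃++ (∈-resp-↭ (↭-sym p) (here refl))
... | us , vs , refl with wordOf-surjective k m (us ++ vs) (drop-mid us [] p)
...   | inj₂ b = inj₂ (Bad-⊆ (skip-mid us) b)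
...   | inj₁ ((_ , _ , c) , eq) with find-site (decode k c) us vs (sym eq)
...     | inj₂ b = inj₂ b
...     | inj₁ (_ , _ , s , refl) = inj₁ ((_ , _ , (c ▸ s)) ,
          cong (λ X → us ++ suc m ∷ X) (++-cancelˡ us _ _ (trans (parent-eq k c s) eq)))

-- Statistics of lists

LrmaxL LrminL BrL IarL InnerBr IdesL : List ℕ → ℕ → Set
Sorted : List ℕ → Set
Sorted xs = ∀ x y → x ∷ y ∷ [] ⊆ xs → x < y

LrmaxL xs v = ∃₂ λ us vs → xs ≡ us ++ v ∷ vs × All (_< v) us
LrminL xs v = ∃₂ λ us vs → xs ≡ us ++ v ∷ vs × All (v <_) us
-- The left neighbour is already smaller because `v` is a left-to-right maximum. At the end of the
-- word `take 1 vs` is empty, which encodes the convention that a zero follows.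
BrL xs v = ∃₂ λ us vs → xs ≡ us ++ v ∷ vs × All (_< v) us × All (_< v) (take 1 vs)
IarL xs v = ∃₂ λ us vs → xs ≡ us ++ v ∷ vs × Sorted (us ++ v ∷ [])
IdesL xs v = suc v ∷ v ∷ [] ⊆ xs
-- Members v of Br that stay in Br when a letter greater than all of xs is appended.
InnerBr xs v = ∃₂ λ us b → ∃[ vs ] xs ≡ us ++ v ∷ b ∷ vs × All (_< v) us × b < v

++-split₃ : ∀ {A : Set} (us : List A) {v vs} xs {x B} → us ++ v ∷ vs ≡ xs ++ x ∷ B →
  (∃[ r ] xs ≡ us ++ v ∷ r × vs ≡ r ++ x ∷ B) ⊎ (us ≡ xs × v ≡ x × vs ≡ B) ⊎
  (∃[ C ] us ≡ xs ++ x ∷ C × B ≡ C ++ v ∷ vs)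
++-split₃ us xs eq with ++-split us xs eq
... | inj₁ ([] , refl , refl) = inj₂ (inj₁ (sym (++-identityʳ us) , refl , refl))
... | inj₁ (_ ∷ r , refl , refl) = inj₁ (r , refl , refl)
... | inj₂ C = inj₂ (inj₂ C)

module _ {ℓ xs B} (xs<ℓ : All (_< ℓ) xs) (B<ℓ : All (_< ℓ) B) where

  -- ℓ stands before all of `B` and exceeds it, so no left-to-right maximum lies in `B`.
  not-after : ∀ {us v vs} {C : Set} → All (_< v) us → ∃[ D ] us ≡ xs ++ ℓ ∷ D × B ≡ D ++ v ∷ vs → C
  not-after {v = v} us<v (D , refl , refl) =
    ⊥-elim (<-asym (All.lookup B<ℓ (∈-++⁺ʳ D (here refl))) (All.lookup us<v (∈-++⁺ʳ xs (here refl))))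

  lrmax-block : ∀ {v} → LrmaxL (xs ++ ℓ ∷ B) v ⇔ (LrmaxL xs v ⊎ v ≡ ℓ)
  lrmax-block {v} = mk⇔ to from
    where
    to : LrmaxL (xs ++ ℓ ∷ B) v → LrmaxL xs v ⊎ v ≡ ℓ
    to (us , vs , eq , us<v) with ++-split₃ us xs (sym eq)
    ... | inj₁ (r , refl , _) = inj₁ (us , r , refl , us<v)
    ... | inj₂ (inj₁ (_ , v≡ℓ , _)) = inj₂ v≡ℓ
    ... | inj₂ (inj₂ D) = not-after us<v D
    from : LrmaxL xs v ⊎ v ≡ ℓ → LrmaxL (xs ++ ℓ ∷ B) v
    from (inj₁ (us , vs , refl , us<v)) = us , vs ++ ℓ ∷ B , ++-assoc us _ _ , us<v
    from (inj₂ refl) = xs , B , refl , xs<ℓ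

  br-block : ∀ {v} → BrL (xs ++ ℓ ∷ B) v ⇔ (InnerBr xs v ⊎ v ≡ ℓ)
  br-block {v} = mk⇔ to from
    where
    to : BrL (xs ++ ℓ ∷ B) v → InnerBr xs v ⊎ v ≡ ℓ
    to (us , vs , eq , us<v , p) with ++-split₃ us xs (sym eq)
    -- If `v` ends `xs`, its right neighbour is ℓ, which is larger.
    to (us , vs , eq , us<v , ℓ<v ∷ []) | inj₁ ([] , refl , refl) =
      ⊥-elim (<-asym ℓ<v (All.lookup xs<ℓ (∈-++⁺ʳ us (here refl))))
    to (us , vs , eq , us<v , b<v ∷ []) | inj₁ (b ∷ r , refl , refl) = inj₁ (us , b , r , refl , us<v , b<v)
    ... | inj₂ (inj₁ (_ , v≡ℓ , _)) = inj₂ v≡ℓ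
    ... | inj₂ (inj₂ D) = not-after us<v D
    from : InnerBr xs v ⊎ v ≡ ℓ → BrL (xs ++ ℓ ∷ B) v
    from (inj₁ (us , b , vs , refl , us<v , b<v)) = us , _ , ++-assoc us _ _ , us<v , b<v ∷ []
    from (inj₂ refl) = xs , B , refl , xs<ℓ , All.take⁺ 1 B<ℓ

  inner-br-block : ∀ {v} → InnerBr (xs ++ ℓ ∷ B) v ⇔ (InnerBr xs v ⊎ (v ≡ ℓ × B ≢ []))
  inner-br-block {v} = mk⇔ to from
    where
    to : InnerBr (xs ++ ℓ ∷ B) v → InnerBr xs v ⊎ (v ≡ ℓ × B ≢ [])
    to (us , b , vs , eq , us<v , b<v) with ++-split₃ us xs (sym eq)
    ... | inj₁ ([] , refl , refl) = ⊥-elim (<-asym b<v (All.lookup xs<ℓ (∈-++⁺ʳ us (here refl))))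
    ... | inj₁ (_ ∷ r , refl , refl) = inj₁ (us , b , r , refl , us<v , b<v)
    ... | inj₂ (inj₁ (_ , refl , refl)) = inj₂ (refl , λ ())
    ... | inj₂ (inj₂ D) = not-after us<v D
    nonempty : ∀ C → All (_< ℓ) C → C ≢ [] → InnerBr (xs ++ ℓ ∷ C) ℓ
    nonempty [] _ ≢[] = ⊥-elim (≢[] refl)
    nonempty (b ∷ C) (b<ℓ ∷ _) _ = xs , b , C , refl , xs<ℓ , b<ℓ
    from : InnerBr xs v ⊎ (v ≡ ℓ × B ≢ []) → InnerBr (xs ++ ℓ ∷ B) v
    from (inj₁ (us , b , vs , refl , us<v , b<v)) = us , b , _ , ++-assoc us _ _ , us<v , b<v
    from (inj₂ (refl , B≢[])) = nonempty B B<ℓ B≢[]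

  sorted-snoc : Sorted xs → Sorted (xs ++ ℓ ∷ [])
  sorted-snoc sorted _ _ s with ⊆-split xs s
  ... | [] , _ , refl , _ , (_ ∷ʳ ())
  ... | [] , _ , refl , _ , (_ ∷ ())
  ... | _ ∷ [] , _ , refl , s₁ , (refl ∷ _) = All-⊆ xs<ℓ s₁
  ... | _ ∷ _ ∷ [] , [] , refl , s₁ , _ = sorted _ _ s₁

  iar-block : ∀ {v} → IarL (xs ++ ℓ ∷ B) v ⇔ (IarL xs v ⊎ (v ≡ ℓ × Sorted xs))
  iar-block {v} = mk⇔ to from
    where
    to : IarL (xs ++ ℓ ∷ B) v → IarL xs v ⊎ (v ≡ ℓ × Sorted xs)
    to (us , vs , eq , sorted) with ++-split₃ us xs (sym eq)
    ... | inj₁ (r , refl , _) = inj₁ (us , r , refl , sorted)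
    ... | inj₂ (inj₁ (refl , refl , _)) = inj₂ (refl , λ _ _ s → sorted _ _ (++⁺ʳ _ s))
    -- In a sorted prefix the last letter `v` exceeds all earlier ones, so it is a left-to-right
    -- maximum.
    ... | inj₂ (inj₂ D) = not-after (All.tabulate λ i → sorted _ _ (++⁺ (from∈ i) ⊆-refl)) D
    from : IarL xs v ⊎ (v ≡ ℓ × Sorted xs) → IarL (xs ++ ℓ ∷ B) v
    from (inj₁ (us , vs , refl , sorted)) = us , vs ++ ℓ ∷ B , ++-assoc us _ _ , sorted
    from (inj₂ (refl , sorted)) = xs , B , refl , sorted-snoc sorted

  sorted-block : Sorted (xs ++ ℓ ∷ B) ⇔ (B ≡ [] × Sorted xs)
  sorted-block = mk⇔ (λ sorted → empty B B<ℓ sorted , λ _ _ s → sorted _ _ (++⁺ʳ _ s))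
                     (λ { (refl , sorted) → sorted-snoc sorted })
    where
    empty : ∀ C → All (_< ℓ) C → Sorted (xs ++ ℓ ∷ C) → C ≡ []
    empty [] _ _ = refl
    empty (b ∷ C) (b<ℓ ∷ _) sorted = ⊥-elim (<-asym b<ℓ (sorted _ _ (++⁺ˡ xs (refl ∷ refl ∷ minimum C))))

-- Statistics read off the state.

LrmaxS MarkedS IarS : State → ℕ → Set
Unmarked : State → Set
LrmaxS [] v = ⊥
LrmaxS ((ℓ , _) ∷ S) v = LrmaxS S v ⊎ v ≡ ℓ
MarkedS [] v = ⊥
MarkedS ((ℓ , f) ∷ S) v = MarkedS S v ⊎ (v ≡ ℓ × f ≡ true)
Unmarked [] = ⊤
Unmarked ((_ , f) ∷ S) = f ≡ false × Unmarked S
IarS [] v = ⊥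
IarS ((ℓ , _) ∷ S) v = IarS S v ⊎ (v ≡ ℓ × Unmarked S)

⇔-const : ∀ {A B : Set} → A → B → A ⇔ B
⇔-const a b = mk⇔ (const b) (const a)

⇔-empty : ∀ {A B : Set} → ¬ A → ¬ B → A ⇔ B
⇔-empty ¬a ¬b = mk⇔ (⊥-elim ∘ ¬a) (⊥-elim ∘ ¬b)

[]-no-split : ∀ {A : Set} (us : List A) {v vs} → [] ≢ us ++ v ∷ vs
[]-no-split [] ()
[]-no-split (_ ∷ _) ()

low-lrmax : ∀ {k S v} (lo : Low k S) → LrmaxL (flat lo) v ⇔ LrmaxS S v
low-lrmax [] = ⇔-empty (λ (us , _ , eq , _) → []-no-split us eq) id
low-lrmax (run lo p) = (low-lrmax lo ⊎-⇔ ⇔-id _) ⇔-∘ lrmax-block p []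
low-lrmax (blk lo p _ _ q _ _) = (low-lrmax lo ⊎-⇔ ⇔-id _) ⇔-∘ lrmax-block p q

low-br : ∀ {k S v} (lo : Low k S) → InnerBr (flat lo) v ⇔ MarkedS S v
low-br [] = ⇔-empty (λ (us , _ , _ , eq , _) → []-no-split us eq) id
low-br (run lo p) = (low-br lo ⊎-⇔ (⇔-id _ ×-⇔ ⇔-empty (λ h → h refl) (λ ()))) ⇔-∘ inner-br-block p []
low-br (blk lo p _ _ q _ _) = (low-br lo ⊎-⇔ (⇔-id _ ×-⇔ ⇔-const (λ ()) refl)) ⇔-∘ inner-br-block p q

low-sorted : ∀ {k S} (lo : Low k S) → Sorted (flat lo) ⇔ Unmarked S
low-sorted [] = mk⇔ (λ _ → tt) (λ _ _ _ ())
low-sorted (run lo p) = (⇔-const refl refl ×-⇔ low-sorted lo) ⇔-∘ sorted-block p []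
low-sorted (blk lo p _ _ q _ _) = (⇔-empty (λ ()) (λ ()) ×-⇔ low-sorted lo) ⇔-∘ sorted-block p q

low-iar : ∀ {k S v} (lo : Low k S) → IarL (flat lo) v ⇔ IarS S v
low-iar [] = ⇔-empty (λ (us , _ , eq , _) → []-no-split us eq) id
low-iar (run lo p) = (low-iar lo ⊎-⇔ (⇔-id _ ×-⇔ low-sorted lo)) ⇔-∘ iar-block p []
low-iar (blk lo p _ _ q _ _) = (low-iar lo ⊎-⇔ (⇔-id _ ×-⇔ low-sorted lo)) ⇔-∘ iar-block p q

module _ {k m f S} {v : ℕ} (w : Structured k m f S) where

  -- Here and in the next two lemmas the right-hand side depends on the state and on `m` but not on
  -- the class, so words with the same code share these statistics.
  word-lrmax : LrmaxL (word w) v ⇔ (LrmaxS S v ⊎ v ≡ m)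
  word-lrmax = (low-lrmax (low w) ⊎-⇔ ⇔-id _) ⇔-∘ lrmax-block (low< w) (rest< w)

  word-br : BrL (word w) v ⇔ (MarkedS S v ⊎ v ≡ m)
  word-br = (low-br (low w) ⊎-⇔ ⇔-id _) ⇔-∘ br-block (low< w) (rest< w)

  word-iar : IarL (word w) v ⇔ (IarS S v ⊎ (v ≡ m × Unmarked S))
  word-iar = (low-iar (low w) ⊎-⇔ (⇔-id _ ×-⇔ low-sorted (low w))) ⇔-∘ iar-block (low< w) (rest< w)

-- Statistics read off the path.

module _ {n us vs} (us<n : All (_< n) us) (vs<n : All (_< n) vs) where

  -- The largest letter can be a left-to-right minimum only in front, and it never prevents a later
  -- letter from being one.
  lrmin-insert : ∀ {v} → LrminL (us ++ n ∷ vs) v ⇔ (LrminL (us ++ vs) v ⊎ (v ≡ n × us ≡ []))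
  lrmin-insert {v} = mk⇔ to from
    where
    no-smaller : ∀ {xs} → All (_< n) xs → All (n <_) xs → xs ≡ []
    no-smaller [] [] = refl
    no-smaller (p ∷ _) (q ∷ _) = ⊥-elim (<-asym p q)
    to : LrminL (us ++ n ∷ vs) v → LrminL (us ++ vs) v ⊎ (v ≡ n × us ≡ [])
    to (us′ , vs′ , eq , v<us′) with ++-split₃ us′ us (sym eq)
    ... | inj₁ (r , refl , refl) = inj₁ (us′ , r ++ vs , ++-assoc us′ _ _ , v<us′)
    ... | inj₂ (inj₁ (refl , refl , _)) = inj₂ (refl , no-smaller us<n v<us′)
    ... | inj₂ (inj₂ (D , refl , refl)) = inj₁ (us ++ D , vs′ , sym (++-assoc us _ _) ,
            All-resp-⊆ (skip-mid us) v<us′)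
    from : LrminL (us ++ vs) v ⊎ (v ≡ n × us ≡ []) → LrminL (us ++ n ∷ vs) v
    from (inj₂ (refl , refl)) = [] , vs , refl , []
    from (inj₁ (us′ , vs′ , eq , v<us′)) with ++-split us us′ eq
    ... | inj₁ (r , refl , refl) = us ++ n ∷ r , vs′ , sym (++-assoc us _ _) ,
            All.++⁺ (All.++⁻ˡ us v<us′) (All.lookup vs<n (∈-++⁺ʳ r (here refl)) ∷ All.++⁻ʳ us v<us′)
    ... | inj₂ (C , refl , refl) = us′ , C ++ n ∷ vs , ++-assoc us′ _ _ , v<us′

  -- Old values keep their relative order; the only new pair of consecutive values is `n` with its
  -- predecessor.
  ides-insert : ∀ {v} → IdesL (us ++ n ∷ vs) v ⇔ (IdesL (us ++ vs) v ⊎ (suc v ≡ n × v ∈ vs))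
  ides-insert {v} = mk⇔ to from
    where
    to : IdesL (us ++ n ∷ vs) v → IdesL (us ++ vs) v ⊎ (suc v ≡ n × v ∈ vs)
    to s with ⊆-split us s
    ... | zs₁ , zs₂ , eq , s₁ , (_ ∷ʳ s₂) = inj₁ (subst (_⊆ us ++ vs) (sym eq) (++⁺ s₁ s₂))
    ... | [] , _ , refl , _ , (refl ∷ s₂) = inj₂ (refl , to∈ s₂)
    ... | _ ∷ [] , _ , refl , s₁ , (refl ∷ _) = ⊥-elim (<-asym (n<1+n v) (All-⊆ us<n s₁))
    ... | _ ∷ _ ∷ [] , _ , () , _ , (refl ∷ _)
    ... | _ ∷ _ ∷ _ ∷ _ , _ , () , _ , (refl ∷ _)
    from : IdesL (us ++ vs) v ⊎ (suc v ≡ n × v ∈ vs) → IdesL (us ++ n ∷ vs) v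
    from (inj₁ s) = ⊆-trans s (skip-mid us)
    from (inj₂ (refl , i)) = ++⁺ˡ us (refl ∷ from∈ i)

isBefore : ∀ {m f S g T} → Site m f S g T → Set
isBefore (before _) = ⊤
isBefore _ = ⊥

-- An insertion left of the old maximum inverts the two largest values, and the new state is empty
-- exactly for an insertion in front. Neither condition mentions the class.
IdesC LrminC : ∀ {m f S} → Code m f S → ℕ → Set
IdesC root v = ⊥
IdesC {suc m} (c ▸ s) v = IdesC c v ⊎ (suc v ≡ suc m × isBefore s)
LrminC root v = v ≡ 0
LrminC {suc m} {S = T} (c ▸ s) v = LrminC c v ⊎ (v ≡ suc m × T ≡ [])

flat-empty : ∀ {k S} (lo : Low k S) → flat lo ≡ [] ⇔ S ≡ []
flat-empty [] = ⇔-const refl refl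
flat-empty (run lo _) = ⇔-empty ([]-no-split (flat lo) ∘ sym) (λ ())
flat-empty (blk lo _ _ _ _ _ _) = ⇔-empty ([]-no-split (flat lo) ∘ sym) (λ ())

old-max-moves : ∀ {k m f S g T} (w : Structured k m f S) (s : Site m f S g T) →
  m ∈ rest (proj₁ (insertMax w s)) ⇔ isBefore s
old-max-moves w at = ⇔-empty (λ i → <-irrefl refl (All.lookup (rest< w) i)) id
old-max-moves {I} (str _ _ (_ ∷ _) (_ ∷ B<) (aboveI _)) after = ⇔-empty (λ i → <-irrefl refl (All.lookup B< i)) id
old-max-moves {II} (str _ _ (_ ∷ _) _ (aboveII _)) after = ⇔-empty (λ ()) id
old-max-moves w (before s) = ⇔-const (∈-++⁺ʳ (cutʳ (low w) s) (here refl)) tt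

decode-ides : ∀ k {m f S v} (c : Code m f S) → IdesL (word (decode k c)) v ⇔ IdesC c v
decode-ides k root = ⇔-empty (λ { (_ ∷ʳ ()) ; (_ ∷ ()) }) id
decode-ides k {v = v} (c ▸ s) =
  (subst (λ xs → IdesL xs v ⇔ IdesC c v) (sym (parent-eq k c s)) (decode-ides k c) ⊎-⇔ last) ⇔-∘
  ides-insert (low< w) (rest< w)
  where
  w = decode k (c ▸ s)
  last : (suc v ≡ suc _ × v ∈ rest w) ⇔ (suc v ≡ suc _ × isBefore s)
  last = mk⇔ (λ { (refl , i) → refl , Equivalence.to (old-max-moves (decode k c) s) i })
             (λ { (refl , i) → refl , Equivalence.from (old-max-moves (decode k c) s) i })

decode-lrmin : ∀ k {m f S v} (c : Code m f S) → LrminL (word (decode k c)) v ⇔ LrminC c v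
decode-lrmin k root = mk⇔ (λ { ([] , _ , refl , _) → refl
                             ; (_ ∷ us , _ , eq , _) → ⊥-elim ([]-no-split us (proj₂ (∷-injective eq))) })
                          (λ { refl → [] , [] , refl , [] })
decode-lrmin k {v = v} (c ▸ s) =
  (subst (λ xs → LrminL xs v ⇔ LrminC c v) (sym (parent-eq k c s)) (decode-lrmin k c) ⊎-⇔
    (⇔-id _ ×-⇔ flat-empty (low w))) ⇔-∘
  lrmin-insert (low< w) (rest< w)
  where
  w = decode k (c ▸ s)

-- From words to lists

toL : ∀ {k m} → Vec (Fin k) m → List ℕ
toL [] = []
toL (x ∷ w) = toℕ x ∷ toL w

toL-injective : ∀ {k m} (w w′ : Vec (Fin k) m) → toL w ≡ toL w′ → w ≡ w′
toL-injective [] [] _ = refl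
toL-injective (x ∷ w) (y ∷ w′) eq with ∷-injective eq
... | x≡y , eq′ = cong₂ _∷_ (toℕ-injective x≡y) (toL-injective w w′ eq′)

length-toL : ∀ {k m} (w : Vec (Fin k) m) → length (toL w) ≡ m
length-toL [] = refl
length-toL (_ ∷ w) = cong suc (length-toL w)

toL-< : ∀ {k m} (w : Vec (Fin k) m) → All (_< k) (toL w)
toL-< [] = []
toL-< (x ∷ w) = toℕ<n x ∷ toL-< w

fromL : ∀ {k m} xs → length xs ≡ m → All (_< k) xs → Σ (Vec (Fin k) m) λ w → toL w ≡ xs
fromL [] refl [] = [] , refl
fromL (x ∷ xs) refl (x< ∷ xs<) with w , eq ← fromL xs refl xs< =
  fromℕ< x< ∷ w , cong₂ _∷_ (toℕ-fromℕ< x<) eq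

-- Ties a position to the lists of letters before and behind it, so that conditions on indices turn
-- into conditions on lists.
data Split {k} : ∀ {m} → Vec (Fin k) m → Fin m → List ℕ → List ℕ → Set where
  here  : ∀ {m x} {w : Vec (Fin k) m} → Split (x ∷ w) zero [] (toL w)
  there : ∀ {m y i us vs} {w : Vec (Fin k) m} → Split w i us vs → Split (y ∷ w) (suc i) (toℕ y ∷ us) vs

split-at : ∀ {k m} (w : Vec (Fin k) m) i → ∃₂ (Split w i)
split-at (x ∷ w) zero = _ , _ , here
split-at (x ∷ w) (suc i) with _ , _ , sp ← split-at w i = _ , _ , there sp

split-≡ : ∀ {k m i us vs} {w : Vec (Fin k) m} → Split w i us vs → toL w ≡ us ++ toℕ (lookup w i) ∷ vs
split-≡ here = refl
split-≡ (there sp) = cong (_ ∷_) (split-≡ sp)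

split-from : ∀ {k m} (w : Vec (Fin k) m) us {x vs} → toL w ≡ us ++ x ∷ vs →
  ∃[ i ] toℕ (lookup w i) ≡ x × Split w i us vs
split-from [] us eq = ⊥-elim ([]-no-split us eq)
split-from (x ∷ w) [] refl = zero , refl , here
split-from (x ∷ w) (u ∷ us) eq with ∷-injective eq
... | refl , eq′ with i , eqᵢ , sp ← split-from w us eq′ = suc i , eqᵢ , there sp

module _ {P : ℕ → Set} {k : ℕ} where

  split-before : ∀ {m i us vs} {w : Vec (Fin k) m} → Split w i us vs →
    (∀ j → j F.< i → P (toℕ (lookup w j))) ⇔ All P us
  split-before sp = mk⇔ (to sp) (from sp)
    where
    to : ∀ {m i us vs} {w : Vec (Fin k) m} → Split w i us vs →
      (∀ j → j F.< i → P (toℕ (lookup w j))) → All P us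
    to here _ = []
    to (there sp) h = h zero (s≤s z≤n) ∷ to sp (λ j j<i → h (suc j) (s≤s j<i))
    from : ∀ {m i us vs} {w : Vec (Fin k) m} → Split w i us vs →
      All P us → ∀ j → j F.< i → P (toℕ (lookup w j))
    from (there sp) (p ∷ _) zero _ = p
    from (there sp) (_ ∷ ps) (suc j) (s≤s j<i) = from sp ps j j<i

  split-next : ∀ {m i us vs} {w : Vec (Fin k) m} → Split w i us vs →
    (∀ j → toℕ j ≡ suc (toℕ i) → P (toℕ (lookup w j))) ⇔ All P (take 1 vs)
  split-next sp = mk⇔ (to sp) (from sp)
    where
    to : ∀ {m i us vs} {w : Vec (Fin k) m} → Split w i us vs →
      (∀ j → toℕ j ≡ suc (toℕ i) → P (toℕ (lookup w j))) → All P (take 1 vs)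
    to {w = _ ∷ []} here _ = []
    to {w = _ ∷ _ ∷ _} here h = h (suc zero) refl ∷ []
    to (there sp) h = to sp (λ j eq → h (suc j) (cong suc eq))
    from : ∀ {m i us vs} {w : Vec (Fin k) m} → Split w i us vs →
      All P (take 1 vs) → ∀ j → toℕ j ≡ suc (toℕ i) → P (toℕ (lookup w j))
    from {w = _ ∷ _ ∷ _} here (p ∷ []) (suc zero) refl = p
    from (there sp) ps (suc j) eq = from sp ps j (suc-injective eq)

Ascending : ∀ {k m} → Vec (Fin k) m → Fin m → Set
Ascending {m = m} w i = (j k : Fin m) → toℕ k ≡ suc (toℕ j) → toℕ k ≤ toℕ i → lookup w j F.< lookup w k

-- `Ascending` compares neighbours and `Sorted` all pairs; transitivity along the word bridges the
-- two.
split-sorted : ∀ {k m i us vs} {w : Vec (Fin k) m} → Split w i us vs →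
  Ascending w i ⇔ Sorted (us ++ toℕ (lookup w i) ∷ [])
split-sorted sp = mk⇔ (to sp) (from sp)
  where
  to : ∀ {k m i us vs} {w : Vec (Fin k) m} → Split w i us vs →
    Ascending w i → Sorted (us ++ toℕ (lookup w i) ∷ [])
  to here _ _ _ (_ ∷ʳ ())
  to here _ _ _ (_ ∷ ())
  to (there sp) h _ _ (_ ∷ʳ s) = to sp (λ j k eq k≤i → h (suc j) (suc k) (cong suc eq) (s≤s k≤i)) _ _ s
  to (there here) h _ _ (refl ∷ (refl ∷ _)) = h zero (suc zero) refl (s≤s z≤n)
  to (there (there sp)) h _ _ (refl ∷ (refl ∷ _)) = h zero (suc zero) refl (s≤s z≤n)
  to (there sp@(there _)) h _ _ (refl ∷ (_ ∷ʳ s)) = <-trans (h zero (suc zero) refl (s≤s z≤n))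
    (to sp (λ j k eq k≤i → h (suc j) (suc k) (cong suc eq) (s≤s k≤i)) _ _ (refl ∷ s))
  from : ∀ {k m i us vs} {w : Vec (Fin k) m} → Split w i us vs →
    Sorted (us ++ toℕ (lookup w i) ∷ []) → Ascending w i
  from here sorted _ (suc _) _ ()
  from (there here) sorted zero (suc zero) _ _ = sorted _ _ (refl ∷ refl ∷ [])
  from (there (there sp)) sorted zero (suc zero) _ _ = sorted _ _ (refl ∷ refl ∷ minimum _)
  from (there sp) sorted (suc j) (suc k) eq (s≤s k≤i) =
    from sp (λ _ _ s → sorted _ _ (_ ∷ʳ s)) j k (suc-injective eq) k≤i

-- Sublists as monotone embeddings of positions.

StrictlyMonotone : ∀ {k m} → (Fin k → Fin m) → Set
StrictlyMonotone f = ∀ a b → a F.< b → f a F.< f b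

⊆⇒embedding : ∀ {k m n} (ys : Vec ℕ k) (w : Vec (Fin n) m) → toList ys ⊆ toL w →
  Σ (Fin k → Fin m) λ f → StrictlyMonotone f × (∀ a → toℕ (lookup w (f a)) ≡ lookup ys a)
⊆⇒embedding [] w _ = (λ ()) , (λ ()) , λ ()
⊆⇒embedding (y ∷ ys) (x ∷ w) (_ ∷ʳ s) with f , mono , eq ← ⊆⇒embedding (y ∷ ys) w s =
  suc ∘ f , (λ a b a<b → s≤s (mono a b a<b)) , eq
⊆⇒embedding {suc k} {suc m} (y ∷ ys) (x ∷ w) (refl ∷ s) with f , mono , eq ← ⊆⇒embedding ys w s =
  g , g-mono , λ { zero → refl ; (suc a) → eq a }
  where
  g : Fin (suc k) → Fin (suc m)
  g zero = zero
  g (suc a) = suc (f a)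
  g-mono : StrictlyMonotone g
  g-mono zero (suc b) _ = s≤s z≤n
  g-mono (suc a) (suc b) (s≤s a<b) = s≤s (mono a b a<b)

positive⇒suc : ∀ {m} (i : Fin (suc m)) → 0 < toℕ i → ∃[ j ] i ≡ suc j
positive⇒suc (suc j) _ = j , refl

-- If `f` sends the first position to zero, the two heads match; otherwise monotonicity makes all
-- images positive and the head of the word is skipped.
embedding⇒⊆ : ∀ {k m n} (ys : Vec ℕ k) (w : Vec (Fin n) m) (f : Fin k → Fin m) → StrictlyMonotone f →
  (∀ a → toℕ (lookup w (f a)) ≡ lookup ys a) → toList ys ⊆ toL w
embedding⇒⊆ [] w f _ _ = minimum _
embedding⇒⊆ (y ∷ ys) [] f _ _ with () ← f zero
embedding⇒⊆ {suc k} (y ∷ ys) (x ∷ w) f mono eq with f zero in f₀ | eq zero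
... | zero | refl = refl ∷ embedding⇒⊆ ys w (proj₁ ∘ g) g-mono g-eq
  where
  g : ∀ a → ∃[ j ] f (suc a) ≡ suc j
  g a = positive⇒suc (f (suc a)) (subst (λ i → toℕ i < toℕ (f (suc a))) f₀ (mono zero (suc a) (s≤s z≤n)))
  g-mono : StrictlyMonotone (proj₁ ∘ g)
  g-mono a b a<b = ≤-pred (subst₂ F._<_ (proj₂ (g a)) (proj₂ (g b)) (mono (suc a) (suc b) (s≤s a<b)))
  g-eq : ∀ a → toℕ (lookup w (proj₁ (g a))) ≡ lookup ys a
  g-eq a = trans (cong (λ i → toℕ (lookup (x ∷ w) i)) (sym (proj₂ (g a)))) (eq (suc a))
... | suc i | _ = _ ∷ʳ embedding⇒⊆ (y ∷ ys) w (proj₁ ∘ g) g-mono g-eq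
  where
  f-pos : ∀ a → 0 < toℕ (f a)
  f-pos zero = subst (λ i → 0 < toℕ i) (sym f₀) (s≤s z≤n)
  f-pos (suc a) = ≤-<-trans z≤n (mono zero (suc a) (s≤s z≤n))
  g : ∀ a → ∃[ j ] f a ≡ suc j
  g a = positive⇒suc (f a) (f-pos a)
  g-mono : StrictlyMonotone (proj₁ ∘ g)
  g-mono a b a<b = ≤-pred (subst₂ F._<_ (proj₂ (g a)) (proj₂ (g b)) (mono a b a<b))
  g-eq : ∀ a → toℕ (lookup w (proj₁ (g a))) ≡ lookup (y ∷ ys) a
  g-eq a = trans (cong (λ i → toℕ (lookup (x ∷ w) i)) (sym (proj₂ (g a)))) (eq a)

Increasing : ∀ {k} → Vec ℕ k → Set
Increasing g = ∀ a b → a F.< b → lookup g a < lookup g b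

-- Statistics and patterns of words in terms of lists.

module _ {n} {w : Word n} where

  lrmax-⇔ : ∀ {v} → Lrmax w v ⇔ LrmaxL (toL w) (toℕ v)
  lrmax-⇔ {v} = mk⇔ to from
    where
    to : Lrmax w v → LrmaxL (toL w) (toℕ v)
    to (i , refl , h) with us , vs , sp ← split-at w i = us , vs , split-≡ sp , Equivalence.to (split-before sp) h
    from : LrmaxL (toL w) (toℕ v) → Lrmax w v
    from (us , vs , eq , h) with i , eqᵢ , sp ← split-from w us eq =
      i , toℕ-injective eqᵢ , Equivalence.from (split-before sp) h

  lrmin-⇔ : ∀ {v} → Lrmin w v ⇔ LrminL (toL w) (toℕ v)
  lrmin-⇔ {v} = mk⇔ to from
    where
    to : Lrmin w v → LrminL (toL w) (toℕ v)
    to (i , refl , h) with us , vs , sp ← split-at w i = us , vs , split-≡ sp , Equivalence.to (split-before sp) h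
    from : LrminL (toL w) (toℕ v) → Lrmin w v
    from (us , vs , eq , h) with i , eqᵢ , sp ← split-from w us eq =
      i , toℕ-injective eqᵢ , Equivalence.from (split-before sp) h

  iar-⇔ : ∀ {v} → Iar w v ⇔ IarL (toL w) (toℕ v)
  iar-⇔ {v} = mk⇔ to from
    where
    to : Iar w v → IarL (toL w) (toℕ v)
    to (i , refl , h) with us , vs , sp ← split-at w i = us , vs , split-≡ sp , Equivalence.to (split-sorted sp) h
    from : IarL (toL w) (toℕ v) → Iar w v
    from (us , vs , eq , h) with i , eqᵢ , sp ← split-from w us eq =
      i , toℕ-injective eqᵢ , Equivalence.from (split-sorted sp) (subst (λ x → Sorted (us ++ x ∷ [])) (sym eqᵢ) h)

  -- `Lrmax` and `Pk` each supply a position of `v`; injectivity of the word identifies them.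
  br-⇔ : IsPerm w → ∀ {v} → Br w v ⇔ BrL (toL w) (toℕ v)
  br-⇔ perm {v} = mk⇔ to from
    where
    to : Br w v → BrL (toL w) (toℕ v)
    to ((i , refl , h) , (i′ , eq , _ , next)) with refl ← perm i′ i eq | us , vs , sp ← split-at w i =
      us , vs , split-≡ sp , Equivalence.to (split-before sp) h , Equivalence.to (split-next sp) next
    from : BrL (toL w) (toℕ v) → Br w v
    from (us , vs , eq , h , next) with i , eqᵢ , sp ← split-from w us eq with refl ← toℕ-injective eqᵢ =
      let smaller = Equivalence.from (split-before sp) h in
      (i , refl , smaller) ,
      (i , refl , (λ j 1+j≡i → smaller j (≤-reflexive 1+j≡i)) , Equivalence.from (split-next sp) next)

  ides-⇔ : ∀ {v} → Ides w v ⇔ IdesL (toL w) (toℕ v)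
  ides-⇔ {v} = mk⇔ to from
    where
    to : Ides w v → IdesL (toL w) (toℕ v)
    to (p , q , refl , eq , q<p) = embedding⇒⊆ (suc (toℕ v) ∷ toℕ v ∷ []) w (lookup (q ∷ p ∷ []))
      (λ { zero (suc zero) _ → q<p ; (suc zero) (suc zero) (s≤s ()) })
      (λ { zero → eq ; (suc zero) → refl })
    from : IdesL (toL w) (toℕ v) → Ides w v
    from s with f , mono , eq ← ⊆⇒embedding (suc (toℕ v) ∷ toℕ v ∷ []) w s =
      f (suc zero) , f zero , toℕ-injective (eq (suc zero)) , eq zero , mono zero (suc zero) (s≤s z≤n)

  -- `g` holds the values of the occurrence in increasing order, and `p` arranges them. Order is
  -- reflected as well as preserved, by trichotomy.
  ⊆⇒contains : ∀ {l} (p : Vec (Fin l) l) (g : Vec ℕ l) → Increasing g →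
    toList (Vec.map (lookup g) p) ⊆ toL w → Contains w p
  ⊆⇒contains p g incr s with f , mono , eq ← ⊆⇒embedding (Vec.map (lookup g) p) w s =
    f , mono , λ a b → fwd a b , bwd a b
    where
    value : ∀ a → toℕ (lookup w (f a)) ≡ lookup g (lookup p a)
    value a = trans (eq a) (lookup-map a (lookup g) p)
    fwd : ∀ a b → lookup p a F.< lookup p b → lookup w (f a) F.< lookup w (f b)
    fwd a b lt = subst₂ _<_ (sym (value a)) (sym (value b)) (incr _ _ lt)
    bwd : ∀ a b → lookup w (f a) F.< lookup w (f b) → lookup p a F.< lookup p b
    bwd a b lt with F.<-cmp (lookup p a) (lookup p b)
    ... | tri< l _ _ = l
    ... | tri> _ _ g = ⊥-elim (<-asym lt (fwd b a g))
    ... | tri≈ _ e _ = ⊥-elim (<-irrefl (trans (value a) (trans (cong (lookup g) e) (sym (value b)))) lt)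

-- Forbidden occurrences against pattern containment.

patterns : Class → Vec (Fin 4) 4 × Vec (Fin 4) 4
patterns I  = p3124 , p3214
patterns II = p3142 , p3241

InClass : Class → ∀ {n} → Word n → Set
InClass k = InAv (proj₁ (patterns k)) (proj₂ (patterns k))

increasing₄ : ∀ {a b c d} → a < b → b < c → c < d → Increasing (a ∷ b ∷ c ∷ d ∷ [])
increasing₄ a<b b<c c<d zero (suc zero) _ = a<b
increasing₄ a<b b<c c<d zero (suc (suc zero)) _ = <-trans a<b b<c
increasing₄ a<b b<c c<d zero (suc (suc (suc zero))) _ = <-trans a<b (<-trans b<c c<d)
increasing₄ a<b b<c c<d (suc zero) (suc (suc zero)) _ = b<c
increasing₄ a<b b<c c<d (suc zero) (suc (suc (suc zero))) _ = <-trans b<c c<d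
increasing₄ a<b b<c c<d (suc (suc zero)) (suc (suc (suc zero))) _ = c<d
increasing₄ _ _ _ (suc zero) (suc zero) (s≤s ())
increasing₄ _ _ _ (suc (suc zero)) (suc zero) (s≤s ())
increasing₄ _ _ _ (suc (suc zero)) (suc (suc zero)) (s≤s (s≤s ()))
increasing₄ _ _ _ (suc (suc (suc zero))) (suc zero) (s≤s ())
increasing₄ _ _ _ (suc (suc (suc zero))) (suc (suc zero)) (s≤s (s≤s ()))
increasing₄ _ _ _ (suc (suc (suc zero))) (suc (suc (suc zero))) (s≤s (s≤s (s≤s ())))

no-repeat : ∀ {x : ℕ} {xs} → Unique xs → ¬ (x ∷ x ∷ [] ⊆ xs)
no-repeat (_ ∷ u) (_ ∷ʳ s) = no-repeat u s
no-repeat (x∉ ∷ _) (refl ∷ s) = All-⊆ x∉ s refl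

-- Comparing `a` with `b` decides which of the two patterns occurs; equality would repeat a letter.
bad⇒contains : ∀ k {n} {w : Word n} → Unique (toL w) → Bad k (toL w) →
  Contains w (proj₁ (patterns k)) ⊎ Contains w (proj₂ (patterns k))
bad⇒contains k u (bad {c} {a} {b} {d} occ a<c b<c c<d) with <-cmp a b
bad⇒contains I u (bad {c} {a} {b} {d} occ a<c b<c c<d) | tri< a<b _ _ =
  inj₁ (⊆⇒contains p3124 (a ∷ b ∷ c ∷ d ∷ []) (increasing₄ a<b b<c c<d) occ)
bad⇒contains I u (bad {c} {a} {b} {d} occ a<c b<c c<d) | tri> _ _ b<a =
  inj₂ (⊆⇒contains p3214 (b ∷ a ∷ c ∷ d ∷ []) (increasing₄ b<a a<c c<d) occ)
bad⇒contains II u (bad {c} {a} {b} {d} occ a<c b<c c<d) | tri< a<b _ _ =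
  inj₁ (⊆⇒contains p3142 (a ∷ b ∷ c ∷ d ∷ []) (increasing₄ a<b b<c c<d) occ)
bad⇒contains II u (bad {c} {a} {b} {d} occ a<c b<c c<d) | tri> _ _ b<a =
  inj₂ (⊆⇒contains p3241 (b ∷ a ∷ c ∷ d ∷ []) (increasing₄ b<a a<c c<d) occ)
bad⇒contains I u (bad occ _ _ _) | tri≈ _ refl _ =
  ⊥-elim (no-repeat u (⊆-trans (_ ∷ʳ refl ∷ refl ∷ _ ∷ʳ []) occ))
bad⇒contains II u (bad occ _ _ _) | tri≈ _ refl _ =
  ⊥-elim (no-repeat u (⊆-trans (_ ∷ʳ refl ∷ _ ∷ʳ refl ∷ []) occ))

contains⇒⊆ : ∀ {n l} (w : Word n) (p : Vec (Fin l) l) (h : Contains w p) →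
  toList (Vec.tabulate λ a → toℕ (lookup w (proj₁ h a))) ⊆ toL w
contains⇒⊆ w p (f , mono , _) = embedding⇒⊆ _ w f mono λ a → sym (lookup∘tabulate _ a)

private
  0<2 : 0 < 2
  0<2 = s≤s z≤n
  1<2 : 1 < 2
  1<2 = s≤s (s≤s z≤n)
  2<3 : 2 < 3
  2<3 = s≤s (s≤s (s≤s z≤n))

contains⇒bad : ∀ k {n} {w : Word n} →
  Contains w (proj₁ (patterns k)) ⊎ Contains w (proj₂ (patterns k)) → Bad k (toL w)
contains⇒bad I {w = w} (inj₁ h@(_ , _ , ord)) =
  bad (contains⇒⊆ w p3124 h) (proj₁ (ord (# 1) (# 0)) 0<2) (proj₁ (ord (# 2) (# 0)) 1<2) (proj₁ (ord (# 0) (# 3)) 2<3)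
contains⇒bad I {w = w} (inj₂ h@(_ , _ , ord)) =
  bad (contains⇒⊆ w p3214 h) (proj₁ (ord (# 1) (# 0)) 1<2) (proj₁ (ord (# 2) (# 0)) 0<2) (proj₁ (ord (# 0) (# 3)) 2<3)
contains⇒bad II {w = w} (inj₁ h@(_ , _ , ord)) =
  bad (contains⇒⊆ w p3142 h) (proj₁ (ord (# 1) (# 0)) 0<2) (proj₁ (ord (# 3) (# 0)) 1<2) (proj₁ (ord (# 0) (# 2)) 2<3)
contains⇒bad II {w = w} (inj₂ h@(_ , _ , ord)) =
  bad (contains⇒⊆ w p3241 h) (proj₁ (ord (# 1) (# 0)) 1<2) (proj₁ (ord (# 3) (# 0)) 0<2) (proj₁ (ord (# 0) (# 2)) 2<3)

-- Permutations as rearrangements of `downFrom n`.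

lookup∈toL : ∀ {k m} (w : Vec (Fin k) m) i → toℕ (lookup w i) ∈ toL w
lookup∈toL (x ∷ w) zero = here refl
lookup∈toL (x ∷ w) (suc i) = there (lookup∈toL w i)

injective⇒unique : ∀ {k m} (w : Vec (Fin k) m) → (∀ i j → lookup w i ≡ lookup w j → i ≡ j) → Unique (toL w)
injective⇒unique [] _ = []
injective⇒unique (x ∷ w) inj = All.tabulate fresh ∷ injective⇒unique w (λ i j eq → suc-inj (inj (suc i) (suc j) eq))
  where
  fresh : ∀ {y} → y ∈ toL w → toℕ x ≢ y
  fresh y∈ refl with us , vs , eq ← ∈-∃++ y∈ with i , eqᵢ , _ ← split-from w us eq
    with () ← inj zero (suc i) (toℕ-injective (sym eqᵢ))
  suc-inj : ∀ {m} {i j : Fin m} → suc i ≡ suc j → i ≡ j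
  suc-inj refl = refl

unique⇒injective : ∀ {k m} (w : Vec (Fin k) m) → Unique (toL w) → ∀ i j → lookup w i ≡ lookup w j → i ≡ j
unique⇒injective (x ∷ w) _ zero zero _ = refl
unique⇒injective (x ∷ w) (x∉ ∷ _) zero (suc j) refl = ⊥-elim (All.lookup x∉ (lookup∈toL w j) refl)
unique⇒injective (x ∷ w) (x∉ ∷ _) (suc i) zero refl = ⊥-elim (All.lookup x∉ (lookup∈toL w i) refl)
unique⇒injective (x ∷ w) (_ ∷ u) (suc i) (suc j) eq = cong suc (unique⇒injective w u i j eq)

-- Pigeonhole: if the largest value were missing, induction with the smaller bound would make the
-- list one letter too short.
unique⇒↭ : ∀ n {xs} → Unique xs → All (_< n) xs → n ≤ length xs → xs ↭ downFrom n
unique⇒↭ zero {[]} _ _ _ = ↭-refl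
unique⇒↭ zero {_ ∷ _} _ (() ∷ _) _
unique⇒↭ (suc n) {xs} u xs< n≤ with n ∈? xs
... | no n∉xs = ⊥-elim (<-irrefl refl (≤-trans n≤ (≤-reflexive
        (trans (↭-length (unique⇒↭ n u xs<′ (<⇒≤ n≤))) (length-downFrom n)))))
  where
  xs<′ : All (_< n) xs
  xs<′ = All.tabulate λ i → ≤∧≢⇒< (≤-pred (All.lookup xs< i)) λ { refl → n∉xs i }
... | yes n∈xs with us , vs , refl ← ∈-∃++ n∈xs with n∉ ∷ u′ ← Unique-resp-↭ (↭⇒↭ₛ (shift n us vs)) u =
  ↭-trans (shift n us vs) (↭-prep n (unique⇒↭ n u′ rest<n
    (≤-pred (≤-trans n≤ (≤-reflexive (↭-length (shift n us vs)))))))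
  where
  rest<n : All (_< n) (us ++ vs)
  rest<n = All.zipWith (λ (n≢ , lt) → ≤∧≢⇒< (≤-pred lt) (n≢ ∘ sym)) (n∉ , All-resp-⊆ (skip-mid us) xs<)

perm-↭ : ∀ {n} (w : Word n) → Unique (toL w) → toL w ↭ downFrom n
perm-↭ w u = unique⇒↭ _ u (toL-< w) (≤-reflexive (sym (length-toL w)))

↭-unique : ∀ {n xs} → xs ↭ downFrom n → Unique xs
↭-unique {n} p = Unique-resp-↭ (↭⇒↭ₛ (↭-sym p)) (downFrom⁺ n)

-- The bijection.

module _ {m : ℕ} where

  fromCode : Class → AnyCode m → Word (suc m)
  fromCode k c@(_ , _ , d) = proj₁ (fromL (wordOf k c)
    (trans (↭-length (decode-↭ k d)) (length-downFrom (suc m)))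
    (All.++⁺ (weaken-< (low< (decode k d))) (n<1+n m ∷ weaken-< (rest< (decode k d)))))

  toL-fromCode : ∀ k (c : AnyCode m) → toL (fromCode k c) ≡ wordOf k c
  toL-fromCode k c = proj₂ (fromL (wordOf k c) _ _)

  code-class : ∀ k (c : AnyCode m) {w : Word (suc m)} → wordOf k c ≡ toL w → InClass k w
  code-class k c@(_ , _ , d) {w} eq =
    unique⇒injective w (subst Unique eq (↭-unique (decode-↭ k d))) ,
    (λ h → avoids (contains⇒bad k (inj₁ h))) , (λ h → avoids (contains⇒bad k (inj₂ h)))
    where
    avoids : ¬ Bad k (toL w)
    avoids = decode-avoids k d ∘ subst (Bad k) (sym eq)

  class-avoids : ∀ k {w : Word (suc m)} → InClass k w → ¬ Bad k (toL w)
  class-avoids k {w} (perm , av₁ , av₂) b with bad⇒contains k (injective⇒unique w perm) b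
  ... | inj₁ h = av₁ h
  ... | inj₂ h = av₂ h

  encode : ∀ k {w : Word (suc m)} → InClass k w → ∃[ c ] wordOf k {m} c ≡ toL w
  encode k {w} cl@(perm , _) with wordOf-surjective k m (toL w) (perm-↭ w (injective⇒unique w perm))
  ... | inj₁ c = c
  ... | inj₂ b = ⊥-elim (class-avoids k cl b)

  -- A word without a class `I` code is returned unchanged; this is only a default value that makes
  -- the map total.
  φ : Word (suc m) → Word (suc m)
  φ w with unique? (toL w)
  ... | no _ = w
  ... | yes u with wordOf-surjective I m (toL w) (perm-↭ w u)
  ...   | inj₁ (c , _) = fromCode II c
  ...   | inj₂ _ = w

  -- Isolates the case analysis in `φ`: injectivity, surjectivity and the statistics use only this
  -- common code.
  φ-code : ∀ w → InClass I w → ∃[ c ] wordOf I {m} c ≡ toL w × wordOf II c ≡ toL (φ w)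
  φ-code w cl@(perm , _) with unique? (toL w)
  ... | no ¬u = ⊥-elim (¬u (injective⇒unique w perm))
  ... | yes u with wordOf-surjective I m (toL w) (perm-↭ w u)
  ...   | inj₁ (c , eq) = c , eq , sym (toL-fromCode II c)
  ...   | inj₂ b = ⊥-elim (class-avoids I cl b)

  φ-injective : ∀ π σ → InClass I π → InClass I σ → φ π ≡ φ σ → π ≡ σ
  φ-injective π σ p q eq with c , cI , cII ← φ-code π p with d , dI , dII ← φ-code σ q
    with refl ← wordOf-injective II c d (trans cII (trans (cong toL eq) (sym dII))) =
    toL-injective π σ (trans (sym cI) dI)

  φ-surjective : ∀ τ → InClass II τ → ∃[ π ] InClass I π × φ π ≡ τ
  φ-surjective τ q with c , eq ← encode II q = π , π∈ , φπ≡τ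
    where
    π = fromCode I c
    π∈ : InClass I π
    π∈ = code-class I c (sym (toL-fromCode I c))
    φπ≡τ : φ π ≡ τ
    -- The code that `φ` finds for `π` must be `c`, since class `I` words determine their codes.
    φπ≡τ with d , dI , dII ← φ-code π π∈
      with refl ← wordOf-injective I d c (trans dI (toL-fromCode I c)) =
      toL-injective _ _ (trans (sym dII) eq)

-- Equality of the statistics.

module _ {m : ℕ} {π τ : Word (suc m)} {c : AnyCode m} (eqI : wordOf I c ≡ toL π) (eqII : wordOf II c ≡ toL τ) where

  private
    d : Code m (proj₁ c) (proj₁ (proj₂ c))
    d = proj₂ (proj₂ c)

  -- `Q` is the statistic as read off the code. Being the same for both classes, it links the two
  -- words.
  same-set : {A B : Fin (suc m) → Set} {P : List ℕ → ℕ → Set} {Q : ℕ → Set} →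
    (∀ {v} → A v ⇔ P (toL τ) (toℕ v)) → (∀ {v} → B v ⇔ P (toL π) (toℕ v)) →
    (∀ k {v} → P (wordOf k c) v ⇔ Q v) → SameSet A B
  same-set {A} {B} {P} {Q} α β γ v = Equivalence.to e , Equivalence.from e
    where
    e : A v ⇔ B v
    e = ⇔-sym (subst (λ xs → P xs (toℕ v) ⇔ Q (toℕ v)) eqI (γ I) ⇔-∘ β) ⇔-∘
        (subst (λ xs → P xs (toℕ v) ⇔ Q (toℕ v)) eqII (γ II) ⇔-∘ α)

  same-statistics : SameSet (Br τ) (Br π) × SameSet (Ides τ) (Ides π) ×
    SameSet (Lrmax τ) (Lrmax π) × SameSet (Lrmin τ) (Lrmin π) × SameSet (Iar τ) (Iar π)
  same-statistics =
    same-set {P = BrL} (br-⇔ (proj₁ (code-class II c eqII))) (br-⇔ (proj₁ (code-class I c eqI))) (λ k → word-br (decode k d)) ,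
    same-set {P = IdesL} ides-⇔ ides-⇔ (λ k → decode-ides k d) ,
    same-set {P = LrmaxL} lrmax-⇔ lrmax-⇔ (λ k → word-lrmax (decode k d)) ,
    same-set {P = LrminL} lrmin-⇔ lrmin-⇔ (λ k → decode-lrmin k d) ,
    same-set {P = IarL} iar-⇔ iar-⇔ (λ k → word-iar (decode k d))

theorem2p1 : (n : ℕ) → n ≥ 1 →
    Σ (Word n → Word n) λ φ →
    ((π : Word n) → InAv p3124 p3214 π → InAv p3142 p3241 (φ π)) ×
    ((π σ : Word n) → InAv p3124 p3214 π → InAv p3124 p3214 σ → φ π ≡ φ σ → π ≡ σ) ×
    ((τ : Word n) → InAv p3142 p3241 τ → ∃[ π ] (InAv p3124 p3214 π × φ π ≡ τ)) ×
    ((π : Word n) → InAv p3124 p3214 π →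
    SameSet (Br (φ π)) (Br π) × SameSet (Ides (φ π)) (Ides π) ×
    SameSet (Lrmax (φ π)) (Lrmax π) × SameSet (Lrmin (φ π)) (Lrmin π) ×
    SameSet (Iar (φ π)) (Iar π))
theorem2p1 (suc m) _ =
  φ ,
  (λ π p → let c , _ , eqII = φ-code π p in code-class II c eqII) ,
  φ-injective ,
  φ-surjective ,
  (λ π p → let c , eqI , eqII = φ-code π p in same-statistics {c = c} eqI eqII)
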